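{- Let $r\ge 1$ be an integer, let $\mathbb{A}=\{1,2,\ldots,r\}$, and let $\mathcal{R}$ be the right quantum algebra on $\mathbb{A}$. Let $$\mathrm{Bos}=\sum_{w\in\mathbb{A}^*}\binom{\overline{w}}{w},\qquad \mathrm{Ferm}=\sum_{J\subseteq\mathbb{A}}(-1)^{|J|}\sum_{\sigma\in\mathcal{S}_J}(-1)^{\mathrm{inv}\,\sigma}\begin{pmatrix}\sigma(i_1)&\sigma(i_2)&\cdots&\sigma(i_l)\\ i_1&i_2&\cdots&i_l\end{pmatrix},$$ where in the second sum $J=\{i_1<i_2<\cdots<i_l\}$, both regarded as elements of $\mathcal{R}$. Then the identity $$\mathrm{Ferm}\times\mathrm{Bos}=1$$ holds in $\mathcal{R}$.
   Context: A biword on $\mathbb{A}=\{1,\ldots,r\}$ is a $2\times n$ matrix ($n\ge 0$) with entries in $\mathbb{A}$, written $\binom{u}{w}$ with top word $u$ and bottom word $w$, both words of length $n$ over $\mathbb{A}$; $n$ is its length. A biword is viewed as a word in the biletters $\binom{x}{a}$ ($x,a\in\mathbb{A}$; not binomial coefficients), and the product of biwords is concatenation; the biword of length $0$ is $1$. Let $\mathcal{B}$ be the set of all biwords and let $\mathcal{A}=\mathbb{Z}\langle\langle\mathcal{B}\rangle\rangle$ be the $\mathbb{Z}$-algebra of all (possibly infinite) formal sums $\sum_{\alpha\in\mathcal{B}}c(\alpha)\alpha$, $c(\alpha)\in\mathbb{Z}$, with product extending concatenation. The right quantum algebra $\mathcal{R}$ is the associative algebra which is the quotient of $\mathcal{A}$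 by the (two-sided) ideal $\mathcal{I}$ generated by the commutation relations (R1) $\binom{xy}{aa}=\binom{yx}{aa}$, (R2) $\binom{xy}{ab}=\binom{yx}{ab}+\binom{yx}{ba}-\binom{xy}{ba}$, for all $a,b,x,y\in\mathbb{A}$ with $x\ne y$. Elements of $\mathcal{A}$ are identified with their images in $\mathcal{R}$ under the canonical homomorphism. Notation: $\mathbb{A}^*$ is the free monoid generated by $\mathbb{A}$, i.e. the set of all words (including the empty word) over $\mathbb{A}$; $\overline{w}$ is the non-decreasing rearrangement of the word $w$; $\mathcal{S}_J$ is the group of permutations of the set $J$; $\mathrm{inv}\,\sigma$ is the number of inversions of $\sigma$ (pairs $i<j$ in $J$ with $\sigma(i)>\sigma(j)$). The term $J=\emptyset$ contributes $1$ to $\mathrm{Ferm}$.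
   Formalization: The right quantum algebra is taken as the quotient by the closure (coefficientwise convergence) of the ideal generated by (R1), (R2); for the purely algebraic ideal, which has only finite sums, the identity fails for r ≥ 2. -}

module Defs where

open import Data.Bool.Base using (if_then_else_)
open import Data.Fin.Base using (Fin)
import Data.Fin.Properties as Fin
open import Data.Integer.Base as ℤ using (ℤ; 0ℤ; 1ℤ; -1ℤ)
open import Data.List.Base using (List; []; _∷_; _++_; map; foldr; filter; concatMap; zip; length; allFin)
import Data.List.Properties as List
import Data.List.Sort as Sort
import Data.List.Relation.Unary.Unique.DecPropositional as UniqueDec
open import Data.Nat.Base as ℕ using (ℕ; zero; suc)
open import Data.Product.Base using (_×_; _,_; map₁; ∃-syntax)
import Data.Product.Properties as Product
open import Relation.Binary.Definitions using (DecidableEquality)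
open import Relation.Binary.PropositionalEquality.Core using (_≡_; _≢_; _≗_)
open import Relation.Nullary.Decidable.Core using (does)

private variable
  A : Set
  r : ℕ

------------------------------------------------------------------------
-- Words and biwords

-- The alphabet {1 < ⋯ < r} is Fin r with its usual order (letters are shifted
-- by one).
Word : ℕ → Set
Word r = List (Fin r)

-- A biword is a word in the biletters (x , a), x on top and a at the bottom.
Biword : ℕ → Set
Biword r = List (Fin r × Fin r)

-- The biword with top word u and bottom word w.  zip would truncate words of
-- different lengths; it is only ever applied to words of equal length.
biword : Word r → Word r → Biword r
biword = zip

_≟ᵇ_ : DecidableEquality (Biword r)
_≟ᵇ_ = List.≡-dec (Product.≡-dec Fin._≟_ Fin._≟_)

------------------------------------------------------------------------
-- The algebra ℤ⟨⟨B⟩⟩ of formal sums ∑ c(α) α, given by their coefficients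

Series : ℕ → Set
Series r = Biword r → ℤ

-- The biword α, regarded as a formal sum.
⟨_⟩ : Biword r → Series r
⟨ α ⟩ β = if does (α ≟ᵇ β) then 1ℤ else 0ℤ

𝟘 𝟙 : Series r
𝟘 _ = 0ℤ
𝟙 = ⟨ [] ⟩

infixl 6 _⊕_ _⊖_
infixl 7 _⊛_ _·_
infix  8 ⊝_

_⊕_ _⊖_ : Series r → Series r → Series r
(f ⊕ g) α = f α ℤ.+ g α
(f ⊖ g) α = f α ℤ.- g α

⊝_ : Series r → Series r
(⊝ f) α = ℤ.- f α

_·_ : ℤ → Series r → Series r
(c · f) α = c ℤ.* f α

∑ : List A → (A → Series r) → Series r
∑ is f = foldr (λ i s → f i ⊕ s) 𝟘 is

-- All pairs (β , γ) with β ++ γ = α.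
splits : List A → List (List A × List A)
splits []      = ([] , []) ∷ []
splits (x ∷ α) = ([] , x ∷ α) ∷ map (map₁ (x ∷_)) (splits α)

_⊛_ : Series r → Series r → Series r
(f ⊛ g) α = foldr (λ (β , γ) s → f β ℤ.* g γ ℤ.+ s) 0ℤ (splits α)

------------------------------------------------------------------------
-- The right quantum algebra

data Generator {r} : Series r → Set where
  R1 : ∀ {x y} → x ≢ y → ∀ a →
       Generator (⟨ biword (x ∷ y ∷ []) (a ∷ a ∷ []) ⟩
                ⊖ ⟨ biword (y ∷ x ∷ []) (a ∷ a ∷ []) ⟩)
  R2 : ∀ {x y} → x ≢ y → ∀ a b →
       Generator (⟨ biword (x ∷ y ∷ []) (a ∷ b ∷ []) ⟩
                ⊖ (⟨ biword (y ∷ x ∷ []) (a ∷ b ∷ []) ⟩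
                 ⊕ ⟨ biword (y ∷ x ∷ []) (b ∷ a ∷ []) ⟩
                 ⊖ ⟨ biword (x ∷ y ∷ []) (b ∷ a ∷ []) ⟩))

-- The two-sided ideal generated by the commutation relations.  The
-- constructor resp is needed because formal sums are functions and there is
-- no function extensionality.
data Ideal {r} : Series r → Set where
  gen  : ∀ {f} → Generator f → Ideal f
  zer  : Ideal 𝟘
  add  : ∀ {f g} → Ideal f → Ideal g → Ideal (f ⊕ g)
  neg  : ∀ {f} → Ideal f → Ideal (⊝ f)
  mulˡ : ∀ f {g} → Ideal g → Ideal (f ⊛ g)
  mulʳ : ∀ {f} g → Ideal f → Ideal (f ⊛ g)
  resp : ∀ {f g} → f ≗ g → Ideal f → Ideal g

-- The closure of the ideal in ℤ⟨⟨B⟩⟩ for the topology of coefficientwise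
-- convergence.  There are finitely many biwords of each length, so
-- agreement up to length n, for all n, describes this topology.
ClosedIdeal : Series r → Set
ClosedIdeal f = ∀ n → ∃[ g ] Ideal g × (∀ α → length α ℕ.≤ n → f α ≡ g α)

-- Equality in the right quantum algebra.  As the elements are infinite formal
-- sums, the relations have to be applied to infinitely many terms at once,
-- i.e. the quotient is by the closed ideal.  Ideal itself contains only finite
-- sums of f ⊛ g ⊛ h with g a generator, and for r ≥ 2 it does not contain
-- Ferm ⊛ Bos ⊖ 𝟙.
infix 4 _≈_
_≈_ : Series r → Series r → Set
f ≈ g = ClosedIdeal (f ⊖ g)

------------------------------------------------------------------------
-- Bos

-- All words of length n with letters from a given list.
words : List A → ℕ → List (List A)
words xs zero    = [] ∷ []
words xs (suc n) = concatMap (λ x → map (x ∷_) (words xs n)) xs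

-- The non-decreasing rearrangement of a word.
rearrange : Word r → Word r
rearrange {r} = Sort.sort (Fin.≤-decTotalOrder r)

-- The sum over all words w; only the finitely many w of the same length as α
-- can contribute to the coefficient of α.
Bos : ∀ r → Series r
Bos r α = ∑ (words (allFin r) (length α)) (λ w → ⟨ biword (rearrange w) w ⟩) α

------------------------------------------------------------------------
-- Ferm

sublists : List A → List (List A)
sublists []       = [] ∷ []
sublists (x ∷ xs) = map (x ∷_) (sublists xs) ++ sublists xs

-- The subsets J = {i₁ < ⋯ < iₗ} of the alphabet, as increasing words i₁⋯iₗ.
subsets : ∀ r → List (Word r)
subsets r = sublists (allFin r)

-- The permutations σ of J = {i₁ < ⋯ < iₗ}, as words σ(i₁)⋯σ(iₗ): the words
-- of length l in the letters of J, without repetition.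
permutations : Word r → List (Word r)
permutations J = filter (UniqueDec.unique? Fin._≟_) (words J (length J))

-- For the word σ(i₁)⋯σ(iₗ) of a permutation σ this is inv σ.
inv : Word r → ℕ
inv []      = 0
inv (x ∷ u) = length (filter (Fin._<? x) u) ℕ.+ inv u

Ferm : ∀ r → Series r
Ferm r = ∑ (subsets r) λ J →
  (-1ℤ ℤ.^ length J) · ∑ (permutations J) λ σ →
    (-1ℤ ℤ.^ inv σ) · ⟨ biword σ J ⟩

{-# OPTIONS --safe #-}

-- The Koszul complex argument, made explicit.  Write D J v w for the signed sum
-- of the biwords with top σ v and bottom w over all rearrangements σ of J.  The
-- relations make D alternate in the letters of w below σ, and make sums over
-- all rearrangements of (a part of) w independent of the order of the top
-- letters above it.  Let a be the least letter.  The terms of Ferm × Bos in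
-- which a occurs either have a in J or have a in w but not in J.  Both kinds
-- are compared with
--   Y = ∑ D (a ∷ K) (w̄ minus a) (K w)    (K a set of larger letters, a ∈ w):
-- expanding D along the last letter of σ gives the terms of the second kind
-- plus Z, and expanding along the first letter of w gives the terms of the
-- first kind (up to sign) plus the same Z.  Hence they telescope, and one
-- removes the letters of the alphabet one by one.
module Submission where

open import Defs
open import Algebra.Bundles using (CommutativeMonoid)
open import Algebra.Module.Bundles using (LeftModule)
import Algebra.Module.Construct.TensorUnit as TensorUnit
import Algebra.Properties.CommutativeSemigroup as CommutativeSemigroupProperties
import Algebra.Properties.Group as GroupProperties
open import Data.Fin.Base as Fin using (Fin)
import Data.Fin.Properties as Fin
open import Data.Integer.Base as ℤ using (ℤ; 0ℤ; 1ℤ; -1ℤ)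
import Data.Integer.Properties as ℤ
open import Data.Integer.Tactic.RingSolver using (solve-∀)
open import Data.List.Base
  using (List; []; _∷_; _++_; _∷ʳ_; map; foldr; filter; concatMap; length; drop; allFin; downFrom)
import Data.List.Properties as List
import Data.List.Membership.DecPropositional as DecMembership
open import Data.List.Membership.Propositional using (_∈_)
open import Data.List.Membership.Propositional.Properties using (∈-++⁺ʳ; ∈-∃++)
open import Data.List.Relation.Binary.Permutation.Propositional
  using (_↭_; prep; ↭-refl; ↭-sym; ↭-trans; ↭⇒↭ₛ)
import Data.List.Relation.Binary.Permutation.Propositional as Perm
import Data.List.Relation.Binary.Permutation.Propositional.Properties as Perm
open import Data.List.Relation.Binary.Pointwise using (Pointwise-≡⇒≡)
open import Data.List.Relation.Unary.All as All using (All; []; _∷_)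
import Data.List.Relation.Unary.All.Properties as All
open import Data.List.Relation.Unary.AllPairs as AllPairs using (AllPairs; []; _∷_)
import Data.List.Relation.Unary.AllPairs.Properties as AllPairs
open import Data.List.Relation.Unary.Any using (here; there)
import Data.List.Relation.Unary.Sorted.TotalOrder.Properties as Sorted
import Data.List.Relation.Unary.Unique.DecPropositional as UniqueDec
open import Data.List.Relation.Unary.Unique.Propositional using (Unique)
import Data.List.Sort as Sort
open import Data.Nat.Base as ℕ using (ℕ; zero; suc; s≤s; z≤n; _≥_)
import Data.Nat.Properties as ℕ
open import Data.Product.Base using (_×_; _,_; proj₁; proj₂; map₁; ∃-syntax)
import Data.Product.Properties as Product
open import Data.Sum.Base using (_⊎_; inj₁; inj₂)
open import Function.Base using (_∘_)
open import Level using (0ℓ; _⊔_)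
open import Relation.Binary.Definitions using (tri<; tri≈; tri>)
open import Relation.Binary.PropositionalEquality
  using (_≡_; _≢_; _≗_; refl; sym; trans; cong; cong₂; subst; module ≡-Reasoning)
import Relation.Binary.Reasoning.Setoid as SetoidReasoning
open import Relation.Nullary.Decidable.Core using (Dec; yes; no)
open import Relation.Nullary.Negation.Core using (¬_; contradiction)

-- The argument runs in an arbitrary left ℤ-module, for a function of a top and a bottom word that
-- obeys the relations at every pair of adjacent columns. Alternating over a block of columns in
-- front yields such a function again, so the relations can be applied to the right of an
-- alternating block without any product in the quotient. Bos is an infinite sum, while an element
-- of the ideal uses the relations only finitely often. The telescoping sum over the length of w is
-- therefore cut at some N. The boundary term of Y at N need not vanish, but all its biwords have
-- length at least N. Hence the module chosen in the end is that of formal sums modulo the ideal and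
-- modulo the terms of length at least N, one module for each N, as the closed ideal demands. Sums
-- over permutations become sums over all words of a given length: there two adjacent letters are
-- independent indices, and cancellation is an exchange of these indices.

private variable
  A B : Set
  r : ℕ

-- Weights and signs of words.

product : (A → ℤ) → List A → ℤ
product m = foldr (λ x z → m x ℤ.* z) 1ℤ

product-++ : (m : A → ℤ) (u v : List A) → product m (u ++ v) ≡ product m u ℤ.* product m v
product-++ m []      v = sym (ℤ.*-identityˡ _)
product-++ m (x ∷ u) v = trans (cong (m x ℤ.*_) (product-++ m u v)) (sym (ℤ.*-assoc (m x) _ _))

product-swap : (m : A → ℤ) (p : List A) (x y : A) (q : List A) →
               product m (p ++ x ∷ y ∷ q) ≡ product m (p ++ y ∷ x ∷ q)
product-swap m []      x y q = lemma (m x) (m y) _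
  where
  lemma : ∀ a b c → a ℤ.* (b ℤ.* c) ≡ b ℤ.* (a ℤ.* c)
  lemma = solve-∀
product-swap m (z ∷ p) x y q = cong (m z ℤ.*_) (product-swap m p x y q)

product-zero : (m : A → ℤ) {x : A} {u : List A} → m x ≡ 0ℤ → x ∈ u → product m u ≡ 0ℤ
product-zero m {u = y ∷ u} mx (here refl) =
  trans (cong (ℤ._* product m u) mx) (ℤ.*-zeroˡ (product m u))
product-zero m {u = y ∷ _} mx (there x∈) =
  trans (cong (m y ℤ.*_) (product-zero m mx x∈)) (ℤ.*-zeroʳ (m y))

product-const : (m : A → ℤ) {c : ℤ} {u : List A} → All (λ x → m x ≡ c) u →
                product m u ≡ c ℤ.^ length u
product-const m []         = refl
product-const m (eq ∷ eqs) = cong₂ ℤ._*_ eq (product-const m eqs)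

-- The value 0 on the diagonal makes `sign` vanish on words with a repeated letter, so that sums
-- over permutations can be taken over all words.
orient : Fin r → Fin r → ℤ
orient x y with Fin.<-cmp x y
... | tri< _ _ _ = 1ℤ
... | tri≈ _ _ _ = 0ℤ
... | tri> _ _ _ = -1ℤ

orient-< : {x y : Fin r} → x Fin.< y → orient x y ≡ 1ℤ
orient-< {x = x} {y} x<y with Fin.<-cmp x y
... | tri< _ _ _   = refl
... | tri≈ x≮y _ _ = contradiction x<y x≮y
... | tri> x≮y _ _ = contradiction x<y x≮y

orient-> : {x y : Fin r} → y Fin.< x → orient x y ≡ -1ℤ
orient-> {x = x} {y} y<x with Fin.<-cmp x y
... | tri< _ _ y≮x = contradiction y<x y≮x
... | tri≈ _ _ y≮x = contradiction y<x y≮x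
... | tri> _ _ _   = refl

orient-refl : (x : Fin r) → orient x x ≡ 0ℤ
orient-refl x with Fin.<-cmp x x
... | tri< _ x≢x _ = contradiction refl x≢x
... | tri≈ _ _ _   = refl
... | tri> _ x≢x _ = contradiction refl x≢x

orient-swap : (x y : Fin r) → orient x y ≡ ℤ.- orient y x
orient-swap x y with Fin.<-cmp x y
... | tri< x<y _ _  = sym (cong ℤ.-_ (orient-> x<y))
... | tri≈ _ refl _ = sym (cong ℤ.-_ (orient-refl x))
... | tri> _ _ y<x  = sym (cong ℤ.-_ (orient-< y<x))

-- (-1)^inv u if the letters of u are distinct, and 0 otherwise.
sign : Word r → ℤ
sign []      = 1ℤ
sign (x ∷ u) = product (orient x) u ℤ.* sign u

sign-swap : (p : Word r) (x y : Fin r) (q : Word r) →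
            sign (p ++ x ∷ y ∷ q) ≡ ℤ.- sign (p ++ y ∷ x ∷ q)
sign-swap [] x y q = trans (cong (λ o → o ℤ.* X ℤ.* (Y ℤ.* sign q)) (orient-swap x y))
                           (lemma (orient y x) X Y (sign q))
  where
  X = product (orient x) q
  Y = product (orient y) q
  lemma : ∀ o a b c → ℤ.- o ℤ.* a ℤ.* (b ℤ.* c) ≡ ℤ.- (o ℤ.* b ℤ.* (a ℤ.* c))
  lemma = solve-∀
sign-swap (z ∷ p) x y q =
  trans (cong₂ ℤ._*_ (product-swap (orient z) p x y q) (sign-swap p x y q))
        (sym (ℤ.neg-distribʳ-* (product (orient z) (p ++ y ∷ x ∷ q)) _))

sign-∷-∈ : {x : Fin r} {u : Word r} → x ∈ u → sign (x ∷ u) ≡ 0ℤ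
sign-∷-∈ {x = x} {u} x∈u =
  trans (cong (ℤ._* sign u) (product-zero (orient x) (orient-refl x) x∈u)) (ℤ.*-zeroˡ (sign u))

sign-repeat : (p : Word r) (x : Fin r) (q : Word r) → sign (p ++ x ∷ x ∷ q) ≡ 0ℤ
sign-repeat []      x q = sign-∷-∈ {x = x} {x ∷ q} (here refl)
sign-repeat (z ∷ p) x q =
  trans (cong (product (orient z) (p ++ x ∷ x ∷ q) ℤ.*_) (sign-repeat p x q))
        (ℤ.*-zeroʳ (product (orient z) (p ++ x ∷ x ∷ q)))

-- The cofactor of the last letter is a product over the letters of `u`, hence the same for all
-- rearrangements of `u`. The Laplace expansion rests on this.
sign-∷ʳ : (u : Word r) (b : Fin r) → sign (u ∷ʳ b) ≡ sign u ℤ.* product (λ y → orient y b) u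
sign-∷ʳ []      b = refl
sign-∷ʳ (x ∷ u) b =
  trans (cong₂ ℤ._*_ (product-++ (orient x) u (b ∷ [])) (sign-∷ʳ u b))
        (lemma (product (orient x) u) (orient x b) (sign u) _)
  where
  lemma : ∀ a b c d → a ℤ.* (b ℤ.* 1ℤ) ℤ.* (c ℤ.* d) ≡ a ℤ.* c ℤ.* (b ℤ.* d)
  lemma = solve-∀

-- Letters and lengths of the enumerated sublists and words.

module _ {P : A → Set} where

  sublists-All : ∀ {xs} → All P xs → All (All P) (sublists xs)
  sublists-All []         = [] ∷ []
  sublists-All (px ∷ pxs) =
    All.++⁺ (All.map⁺ (All.map (px ∷_) (sublists-All pxs))) (sublists-All pxs)

  words-All : ∀ {xs} → All P xs → ∀ n → All (All P) (words xs n)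
  words-All pxs zero    = [] ∷ []
  words-All pxs (suc n) =
    All.concat⁺ (All.map⁺ (All.map (λ px → All.map⁺ (All.map (px ∷_) (words-All pxs n))) pxs))

sublists-AllPairs : {R : A → A → Set} → ∀ {xs} → AllPairs R xs → All (AllPairs R) (sublists xs)
sublists-AllPairs []         = [] ∷ []
sublists-AllPairs (rx ∷ rxs) =
  All.++⁺ (All.map⁺ (All.zipWith (λ (p , q) → p ∷ q) (sublists-All rx , sublists-AllPairs rxs)))
          (sublists-AllPairs rxs)

words-length : (xs : List A) → ∀ n → All (λ w → length w ≡ n) (words xs n)
words-length xs zero    = refl ∷ []
words-length xs (suc n) =
  All.concat⁺ (All.map⁺ {f = λ x → map (x ∷_) (words xs n)} (All.tabulate {xs = xs} λ _ →
    All.map⁺ (All.map (cong suc) (words-length xs n))))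

-- Finite sums in a ℤ-module.

module Sums {m ℓ} (M : LeftModule ℤ.+-*-ring m ℓ) where

  open LeftModule M renaming (Carrierᴹ to V)
  open CommutativeSemigroupProperties
    (CommutativeMonoid.commutativeSemigroup +ᴹ-commutativeMonoid)
    using (interchange)
  open SetoidReasoning ≈ᴹ-setoid

  sum : List A → (A → V) → V
  sum xs f = foldr (λ x v → f x +ᴹ v) 0ᴹ xs

  private variable
    f g : A → V

  sum-cong : ∀ {xs : List A} → All (λ x → f x ≈ᴹ g x) xs → sum xs f ≈ᴹ sum xs g
  sum-cong []         = ≈ᴹ-refl
  sum-cong (eq ∷ eqs) = +ᴹ-cong eq (sum-cong eqs)

  sum-ext : (∀ x → f x ≈ᴹ g x) → ∀ (xs : List A) → sum xs f ≈ᴹ sum xs g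
  sum-ext f≈g xs = sum-cong (All.universal f≈g xs)

  sum-zero : ∀ {xs : List A} → All (λ x → f x ≈ᴹ 0ᴹ) xs → sum xs f ≈ᴹ 0ᴹ
  sum-zero []         = ≈ᴹ-refl
  sum-zero (eq ∷ eqs) = ≈ᴹ-trans (+ᴹ-cong eq (sum-zero eqs)) (+ᴹ-identityˡ _)

  sum-++ : ∀ (xs ys : List A) (f : A → V) → sum (xs ++ ys) f ≈ᴹ sum xs f +ᴹ sum ys f
  sum-++ []       ys f = ≈ᴹ-sym (+ᴹ-identityˡ _)
  sum-++ (x ∷ xs) ys f = ≈ᴹ-trans (+ᴹ-congˡ (sum-++ xs ys f)) (≈ᴹ-sym (+ᴹ-assoc _ _ _))

  sum-map : ∀ (h : A → B) (xs : List A) (f : B → V) → sum (map h xs) f ≈ᴹ sum xs (f ∘ h)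
  sum-map h []       f = ≈ᴹ-refl
  sum-map h (x ∷ xs) f = +ᴹ-congˡ (sum-map h xs f)

  sum-concatMap : ∀ (h : A → List B) (xs : List A) (f : B → V) →
                  sum (concatMap h xs) f ≈ᴹ sum xs (λ x → sum (h x) f)
  sum-concatMap h []       f = ≈ᴹ-refl
  sum-concatMap h (x ∷ xs) f =
    ≈ᴹ-trans (sum-++ (h x) (concatMap h xs) f) (+ᴹ-congˡ (sum-concatMap h xs f))

  sum-+ : ∀ (xs : List A) (f g : A → V) → sum xs (λ x → f x +ᴹ g x) ≈ᴹ sum xs f +ᴹ sum xs g
  sum-+ []       f g = ≈ᴹ-sym (+ᴹ-identityˡ _)
  sum-+ (x ∷ xs) f g = ≈ᴹ-trans (+ᴹ-congˡ (sum-+ xs f g)) (interchange _ _ _ _)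

  sum-*ₗ : ∀ c (xs : List A) (f : A → V) → c *ₗ sum xs f ≈ᴹ sum xs (λ x → c *ₗ f x)
  sum-*ₗ c []       f = *ₗ-zeroʳ c
  sum-*ₗ c (x ∷ xs) f = ≈ᴹ-trans (*ₗ-distribˡ c _ _) (+ᴹ-congˡ (sum-*ₗ c xs f))

  sum-swap : ∀ (xs : List A) (ys : List B) (f : A → B → V) →
             sum xs (λ x → sum ys (f x)) ≈ᴹ sum ys (λ y → sum xs (λ x → f x y))
  sum-swap []       ys f = ≈ᴹ-sym (sum-zero (All.universal (λ _ → ≈ᴹ-refl) ys))
  sum-swap (x ∷ xs) ys f = ≈ᴹ-trans (+ᴹ-congˡ (sum-swap xs ys f)) (≈ᴹ-sym (sum-+ ys _ _))

  -- Negation as the scalar -1, so that all signs are scalars.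
  neg⇒sum-zero : ∀ {v w} → v ≈ᴹ -1ℤ *ₗ w → v +ᴹ w ≈ᴹ 0ᴹ
  neg⇒sum-zero {v} {w} eq = begin
    v +ᴹ w                    ≈⟨ +ᴹ-cong eq (≈ᴹ-sym (*ₗ-identityˡ w)) ⟩
    -1ℤ *ₗ w +ᴹ 1ℤ *ₗ w       ≈⟨ *ₗ-distribʳ w -1ℤ 1ℤ ⟨
    0ℤ *ₗ w                   ≈⟨ *ₗ-zeroˡ w ⟩
    0ᴹ                        ∎

  sum-zero⇒neg : ∀ {v w} → v +ᴹ w ≈ᴹ 0ᴹ → v ≈ᴹ -1ℤ *ₗ w
  sum-zero⇒neg {v} {w} eq = begin
    v                         ≈⟨ +ᴹ-identityʳ v ⟨
    v +ᴹ 0ᴹ                   ≈⟨ +ᴹ-congˡ (neg⇒sum-zero ≈ᴹ-refl) ⟨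
    v +ᴹ (-1ℤ *ₗ w +ᴹ w)      ≈⟨ +ᴹ-congˡ (+ᴹ-comm _ _) ⟩
    v +ᴹ (w +ᴹ -1ℤ *ₗ w)      ≈⟨ +ᴹ-assoc _ _ _ ⟨
    v +ᴹ w +ᴹ -1ℤ *ₗ w        ≈⟨ +ᴹ-congʳ eq ⟩
    0ᴹ +ᴹ -1ℤ *ₗ w            ≈⟨ +ᴹ-identityˡ _ ⟩
    -1ℤ *ₗ w                  ∎

  -- Off the diagonal the terms cancel in pairs. The diagonal is a separate hypothesis because 2v ≈
  -- 0 does not give v ≈ 0 in a general module; likewise R2 with a = b yields only twice R1.
  alternating-sum : ∀ (xs : List A) {f : A → A → V} →
                    (∀ x y → f x y +ᴹ f y x ≈ᴹ 0ᴹ) → (∀ x → f x x ≈ᴹ 0ᴹ) →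
                    sum xs (λ x → sum xs (f x)) ≈ᴹ 0ᴹ
  alternating-sum []       anti diag = ≈ᴹ-refl
  alternating-sum (x ∷ xs) {f} anti diag = begin
    (f x x +ᴹ sum xs (f x)) +ᴹ sum xs (λ y → f y x +ᴹ sum xs (f y))
      ≈⟨ +ᴹ-cong (+ᴹ-congʳ (diag x)) (sum-+ xs _ _) ⟩
    (0ᴹ +ᴹ sum xs (f x)) +ᴹ (sum xs (λ y → f y x) +ᴹ sum xs (λ y → sum xs (f y)))
      ≈⟨ +ᴹ-cong (+ᴹ-identityˡ _) (≈ᴹ-trans (+ᴹ-congˡ (alternating-sum xs anti diag)) (+ᴹ-identityʳ _)) ⟩
    sum xs (f x) +ᴹ sum xs (λ y → f y x)
      ≈⟨ sum-+ xs _ _ ⟨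
    sum xs (λ y → f x y +ᴹ f y x)
      ≈⟨ sum-zero (All.universal (anti x) xs) ⟩
    0ᴹ ∎

  sum-words-suc : ∀ (xs : List A) n (f : List A → V) →
                  sum (words xs (suc n)) f ≈ᴹ sum xs (λ x → sum (words xs n) (λ w → f (x ∷ w)))
  sum-words-suc xs n f =
    ≈ᴹ-trans (sum-concatMap _ xs f) (sum-ext (λ x → sum-map (x ∷_) (words xs n) f) xs)

  sum-words-∷ʳ : ∀ (xs : List A) n (f : List A → V) →
                 sum (words xs (suc n)) f ≈ᴹ sum xs (λ x → sum (words xs n) (λ w → f (w ∷ʳ x)))
  sum-words-∷ʳ xs zero    f = sum-words-suc xs zero f
  sum-words-∷ʳ xs (suc n) f = begin
    sum (words xs (suc (suc n))) f
      ≈⟨ sum-words-suc xs (suc n) f ⟩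
    sum xs (λ x → sum (words xs (suc n)) (λ w → f (x ∷ w)))
      ≈⟨ sum-ext (λ x → sum-words-∷ʳ xs n (f ∘ (x ∷_))) xs ⟩
    sum xs (λ x → sum xs (λ y → sum (words xs n) (λ w → f (x ∷ w ∷ʳ y))))
      ≈⟨ sum-swap xs xs _ ⟩
    sum xs (λ y → sum xs (λ x → sum (words xs n) (λ w → f (x ∷ w ∷ʳ y))))
      ≈⟨ sum-ext (λ y → sum-words-suc xs n (λ w → f (w ∷ʳ y))) xs ⟨
    sum xs (λ y → sum (words xs (suc n)) (λ w → f (w ∷ʳ y))) ∎

  -- Only one pair of adjacent positions is concerned, since a single use of the relations acts on
  -- one pair of columns.
  record AlternatingAt (i : ℕ) (f : List A → V) : Set (m ⊔ ℓ) where
    field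
      anti : ∀ p x y q → length p ≡ i → f (p ++ x ∷ y ∷ q) +ᴹ f (p ++ y ∷ x ∷ q) ≈ᴹ 0ᴹ
      diag : ∀ p x q → length p ≡ i → f (p ++ x ∷ x ∷ q) ≈ᴹ 0ᴹ

  open AlternatingAt

  sum-words-alternating : ∀ (xs : List A) {i n} {f : List A → V} → 2 ℕ.+ i ℕ.≤ n →
                          AlternatingAt i f → sum (words xs n) f ≈ᴹ 0ᴹ
  sum-words-alternating xs {zero} {suc (suc n)} {f} (s≤s (s≤s _)) alt = begin
    sum (words xs (suc (suc n))) f
      ≈⟨ sum-words-suc xs (suc n) f ⟩
    sum xs (λ x → sum (words xs (suc n)) (λ w → f (x ∷ w)))
      ≈⟨ sum-ext (λ x → sum-words-suc xs n (f ∘ (x ∷_))) xs ⟩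
    sum xs (λ x → sum xs (λ y → sum (words xs n) (λ w → f (x ∷ y ∷ w))))
      ≈⟨ alternating-sum xs
           (λ x y → ≈ᴹ-trans (≈ᴹ-sym (sum-+ (words xs n) _ _))
                             (sum-zero (All.universal (λ q → anti alt [] x y q refl) (words xs n))))
           (λ x → sum-zero (All.universal (λ q → diag alt [] x q refl) (words xs n))) ⟩
    0ᴹ ∎
  sum-words-alternating xs {suc i} {suc n} {f} (s≤s i+2≤n) alt =
    ≈ᴹ-trans (sum-words-suc xs n f)
      (sum-zero (All.universal (λ z → sum-words-alternating xs i+2≤n (record
        { anti = λ p x y q eq → anti alt (z ∷ p) x y q (cong suc eq)
        ; diag = λ p x q eq → diag alt (z ∷ p) x q (cong suc eq) })) xs))

  -- Once b is used as first or last letter of a signed word, the words with a further b contribute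
  -- 0, and the sum passes to the alphabet without b.
  sum-words-drop : ∀ (p : List A) b q n {f : List A → V} → (∀ {u} → b ∈ u → f u ≈ᴹ 0ᴹ) →
                   sum (words (p ++ b ∷ q) n) f ≈ᴹ sum (words (p ++ q) n) f
  sum-words-drop p b q zero    f0 = ≈ᴹ-refl
  sum-words-drop p b q (suc n) {f} f0 = begin
    sum (words (p ++ b ∷ q) (suc n)) f
      ≈⟨ sum-words-suc (p ++ b ∷ q) n f ⟩
    sum (p ++ b ∷ q) F
      ≈⟨ sum-++ p (b ∷ q) F ⟩
    sum p F +ᴹ (F b +ᴹ sum q F)
      ≈⟨ +ᴹ-congˡ (+ᴹ-congʳ (sum-zero (All.universal (λ w → f0 (here refl)) (words (p ++ b ∷ q) n)))) ⟩
    sum p F +ᴹ (0ᴹ +ᴹ sum q F)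
      ≈⟨ +ᴹ-congˡ (+ᴹ-identityˡ _) ⟩
    sum p F +ᴹ sum q F
      ≈⟨ sum-++ p q F ⟨
    sum (p ++ q) F
      ≈⟨ sum-ext (λ x → sum-words-drop p b q n (f0 ∘ there)) (p ++ q) ⟩
    sum (p ++ q) (λ x → sum (words (p ++ q) n) (λ w → f (x ∷ w)))
      ≈⟨ sum-words-suc (p ++ q) n f ⟨
    sum (words (p ++ q) (suc n)) f ∎
    where
    F : _ → V
    F x = sum (words (p ++ b ∷ q) n) (λ w → f (x ∷ w))

  -- In an expansion, `p ++ q` is the set that remains without b, and the length of `q` determines
  -- the sign of the cofactor.
  sumPicks : List A → (List A → A → List A → V) → V
  sumPicks []       f = 0ᴹ
  sumPicks (x ∷ xs) f = f [] x xs +ᴹ sumPicks xs (λ p → f (x ∷ p))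

  sumPicks-cong : ∀ (xs : List A) {f g : List A → A → List A → V} →
                  (∀ p b q → xs ≡ p ++ b ∷ q → f p b q ≈ᴹ g p b q) →
                  sumPicks xs f ≈ᴹ sumPicks xs g
  sumPicks-cong []       f≈g = ≈ᴹ-refl
  sumPicks-cong (x ∷ xs) f≈g =
    +ᴹ-cong (f≈g [] x xs refl)
            (sumPicks-cong xs (λ p b q eq → f≈g (x ∷ p) b q (cong (x ∷_) eq)))

  sumPicks-*ₗ : ∀ c (xs : List A) (f : List A → A → List A → V) →
                c *ₗ sumPicks xs f ≈ᴹ sumPicks xs (λ p b q → c *ₗ f p b q)
  sumPicks-*ₗ c []       f = *ₗ-zeroʳ c
  sumPicks-*ₗ c (x ∷ xs) f = ≈ᴹ-trans (*ₗ-distribˡ c _ _) (+ᴹ-congˡ (sumPicks-*ₗ c xs _))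

  sum≈sumPicks : ∀ (xs : List A) (f : A → V) → sum xs f ≈ᴹ sumPicks xs (λ _ b _ → f b)
  sum≈sumPicks []       f = ≈ᴹ-refl
  sum≈sumPicks (x ∷ xs) f = +ᴹ-congˡ (sum≈sumPicks xs f)

  sumPicks-sum : ∀ (xs : List A) (ys : List B) (f : B → List A → A → List A → V) →
                 sumPicks xs (λ p b q → sum ys (λ y → f y p b q)) ≈ᴹ sum ys (λ y → sumPicks xs (f y))
  sumPicks-sum []       ys f = ≈ᴹ-sym (sum-zero (All.universal (λ _ → ≈ᴹ-refl) ys))
  sumPicks-sum (x ∷ xs) ys f = ≈ᴹ-trans (+ᴹ-congˡ (sumPicks-sum xs ys _)) (≈ᴹ-sym (sum-+ ys _ _))

  sum-sublists-∷ : ∀ x (xs : List A) (f : List A → V) →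
                   sum (sublists (x ∷ xs)) f ≈ᴹ
                   sum (sublists xs) (λ K → f (x ∷ K)) +ᴹ sum (sublists xs) f
  sum-sublists-∷ x xs f =
    ≈ᴹ-trans (sum-++ (map (x ∷_) (sublists xs)) (sublists xs) f)
             (+ᴹ-congʳ (sum-map (x ∷_) (sublists xs) f))

  -- Adding a letter b ∉ K to K amounts to distinguishing a letter of K ∪ {b}.
  sublists-pick : ∀ (xs : List A) (f : List A → A → V) → (∀ {K b} → b ∈ K → f K b ≈ᴹ 0ᴹ) →
                  sum (sublists xs) (λ K → sum xs (f K)) ≈ᴹ
                  sum (sublists xs) (λ K → sumPicks K (λ p b q → f (p ++ q) b))
  sublists-pick []       f f0 = ≈ᴹ-refl
  sublists-pick (x ∷ xs) f f0 = begin
    sum (sublists (x ∷ xs)) (λ K → sum (x ∷ xs) (f K))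
      ≈⟨ sum-sublists-∷ x xs _ ⟩
    sum S (λ K → f (x ∷ K) x +ᴹ sum xs (f (x ∷ K))) +ᴹ sum S (λ K → f K x +ᴹ sum xs (f K))
      ≈⟨ +ᴹ-cong (sum-ext (λ K → ≈ᴹ-trans (+ᴹ-congʳ (f0 (here refl))) (+ᴹ-identityˡ _)) S)
                 (sum-+ S _ _) ⟩
    sum S (λ K → sum xs (f (x ∷ K))) +ᴹ (sum S (λ K → f K x) +ᴹ sum S (λ K → sum xs (f K)))
      ≈⟨ +ᴹ-cong (sublists-pick xs (λ K → f (x ∷ K)) (f0 ∘ there))
                 (+ᴹ-congˡ (sublists-pick xs f f0)) ⟩
    sum S (λ K → sumPicks K (λ p b q → f (x ∷ p ++ q) b)) +ᴹ
      (sum S (λ K → f K x) +ᴹ sum S (λ K → sumPicks K (λ p b q → f (p ++ q) b)))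
      ≈⟨ +ᴹ-assoc _ _ _ ⟨
    sum S (λ K → sumPicks K (λ p b q → f (x ∷ p ++ q) b)) +ᴹ sum S (λ K → f K x) +ᴹ
      sum S (λ K → sumPicks K (λ p b q → f (p ++ q) b))
      ≈⟨ +ᴹ-congʳ (≈ᴹ-trans (+ᴹ-comm _ _) (≈ᴹ-sym (sum-+ S _ _))) ⟩
    sum S (λ K → f K x +ᴹ sumPicks K (λ p b q → f (x ∷ p ++ q) b)) +ᴹ
      sum S (λ K → sumPicks K (λ p b q → f (p ++ q) b))
      ≈⟨ sum-sublists-∷ x xs _ ⟨
    sum (sublists (x ∷ xs)) (λ K → sumPicks K (λ p b q → f (p ++ q) b)) ∎
    where S = sublists xs

-- Alternating sums over the rearrangements of a set.

product-insert : (m : A → ℤ) (p : List A) (b : A) (q : List A) →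
                 product m (p ++ b ∷ q) ≡ m b ℤ.* product m (p ++ q)
product-insert m []      b q = refl
product-insert m (x ∷ p) b q =
  trans (cong (m x ℤ.*_) (product-insert m p b q)) (lemma (m x) (m b) _)
  where
  lemma : ∀ a b c → a ℤ.* (b ℤ.* c) ≡ b ℤ.* (a ℤ.* c)
  lemma = solve-∀

-- The letters of `p` lie below b and contribute 1, those of `q` lie above b and contribute -1. This
-- is the cofactor sign for the last column.
product-orient : (p : Word r) (b : Fin r) (q : Word r) → AllPairs Fin._<_ (p ++ b ∷ q) →
                 product (λ y → orient y b) (p ++ q) ≡ -1ℤ ℤ.^ length q
product-orient []      b q (b<q ∷ _)   = product-const _ (All.map orient-> b<q)
product-orient (x ∷ p) b q (x<pbq ∷ inc) =
  trans (cong₂ ℤ._*_ (orient-< (All.lookup x<pbq (∈-++⁺ʳ p (here refl)))) (product-orient p b q inc))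
        (ℤ.*-identityˡ _)

module Alternation {m ℓ} (M : LeftModule ℤ.+-*-ring m ℓ) (r : ℕ) where

  open LeftModule M renaming (Carrierᴹ to V)
  open Sums M
  open SetoidReasoning ≈ᴹ-setoid

  -- The words with a repeated letter have sign 0, so for a set J only its rearrangements count.
  -- Keeping all words makes adjacent letters independent summation indices.
  alt : Word r → (Word r → V) → V
  alt J f = sum (words J (length J)) (λ u → sign u *ₗ f u)

  alt-cong : ∀ J {f g : Word r → V} → (∀ u → length u ≡ length J → f u ≈ᴹ g u) →
             alt J f ≈ᴹ alt J g
  alt-cong J f≈g =
    sum-cong (All.map (λ eq → *ₗ-cong refl (f≈g _ eq)) (words-length J (length J)))

  alt-+ : ∀ J (f g : Word r → V) → alt J (λ u → f u +ᴹ g u) ≈ᴹ alt J f +ᴹ alt J g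
  alt-+ J f g = ≈ᴹ-trans (sum-ext (λ u → *ₗ-distribˡ (sign u) _ _) (words J (length J)))
    (sum-+ (words J (length J)) _ _)

  -- Exchanging the letters at positions i and i + 1 reverses the sign and leaves `f` unchanged.
  alt-symmetric : ∀ J {i} {f : Word r → V} → 2 ℕ.+ i ℕ.≤ length J →
                  (∀ p x y q → length p ≡ i → f (p ++ x ∷ y ∷ q) ≈ᴹ f (p ++ y ∷ x ∷ q)) →
                  alt J f ≈ᴹ 0ᴹ
  alt-symmetric J {f = f} i+2≤ f-sym = sum-words-alternating J i+2≤ (record
    { anti = λ p x y q eq → neg⇒sum-zero (begin
        sign (p ++ x ∷ y ∷ q) *ₗ f (p ++ x ∷ y ∷ q)
          ≈⟨ *ₗ-cong (trans (sign-swap p x y q) (sym (ℤ.-1*i≡-i (sign (p ++ y ∷ x ∷ q)))))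
                      (f-sym p x y q eq) ⟩
        (-1ℤ ℤ.* sign (p ++ y ∷ x ∷ q)) *ₗ f (p ++ y ∷ x ∷ q)
          ≈⟨ *ₗ-assoc -1ℤ (sign (p ++ y ∷ x ∷ q)) _ ⟩
        -1ℤ *ₗ sign (p ++ y ∷ x ∷ q) *ₗ f (p ++ y ∷ x ∷ q) ∎)
    ; diag = λ p x q _ → ≈ᴹ-trans (*ₗ-cong (sign-repeat p x q) ≈ᴹ-refl) (*ₗ-zeroˡ _)
    })

  -- The value `φ u w` stands for the class of a biword; equal lengths of `p` and `p′` align the
  -- columns. R2 is rearranged so that each side has a single pair on top: summed over both orders
  -- of the bottom letters, `φ` is symmetric in the top letters.
  record RightQuantum (φ : Word r → Word r → V) : Set (m ⊔ ℓ) where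
    field
      rel₁ : ∀ p p′ x y a q q′ → length p ≡ length p′ →
             φ (p ++ x ∷ y ∷ q) (p′ ++ a ∷ a ∷ q′) ≈ᴹ φ (p ++ y ∷ x ∷ q) (p′ ++ a ∷ a ∷ q′)
      rel₂ : ∀ p p′ x y a b q q′ → length p ≡ length p′ →
             φ (p ++ x ∷ y ∷ q) (p′ ++ a ∷ b ∷ q′) +ᴹ φ (p ++ x ∷ y ∷ q) (p′ ++ b ∷ a ∷ q′) ≈ᴹ
             φ (p ++ y ∷ x ∷ q) (p′ ++ a ∷ b ∷ q′) +ᴹ φ (p ++ y ∷ x ∷ q) (p′ ++ b ∷ a ∷ q′)

  module _ {φ : Word r → Word r → V} (rq : RightQuantum φ) where
    open RightQuantum rq

    alt-repeat : ∀ J z a {v t} → 2 ℕ.+ length z ℕ.≤ length J →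
                 alt J (λ u → φ (u ++ v) (z ++ a ∷ a ∷ t)) ≈ᴹ 0ᴹ
    alt-repeat J z a {v} {t} z+2≤J = alt-symmetric J z+2≤J λ p x y q eq → begin
      φ ((p ++ x ∷ y ∷ q) ++ v) (z ++ a ∷ a ∷ t)
        ≡⟨ cong (λ u → φ u (z ++ a ∷ a ∷ t)) (List.++-assoc p (x ∷ y ∷ q) v) ⟩
      φ (p ++ x ∷ y ∷ q ++ v) (z ++ a ∷ a ∷ t)
        ≈⟨ rel₁ p z x y a (q ++ v) t eq ⟩
      φ (p ++ y ∷ x ∷ q ++ v) (z ++ a ∷ a ∷ t)
        ≡⟨ cong (λ u → φ u (z ++ a ∷ a ∷ t)) (List.++-assoc p (y ∷ x ∷ q) v) ⟨
      φ ((p ++ y ∷ x ∷ q) ++ v) (z ++ a ∷ a ∷ t) ∎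

    -- By `rel₂` the sum over both orders of a and b is symmetric in the two letters above them, so
    -- its alternating sum vanishes. The bound on `z` keeps both columns below the alternating
    -- letters.
    alt-swap : ∀ J z a b {v t} → 2 ℕ.+ length z ℕ.≤ length J →
               alt J (λ u → φ (u ++ v) (z ++ a ∷ b ∷ t)) ≈ᴹ
               -1ℤ *ₗ alt J (λ u → φ (u ++ v) (z ++ b ∷ a ∷ t))
    alt-swap J z a b {v} {t} z+2≤J = sum-zero⇒neg (≈ᴹ-trans (≈ᴹ-sym (alt-+ J _ _))
      (alt-symmetric J z+2≤J λ p x y q eq → begin
        Φ ((p ++ x ∷ y ∷ q) ++ v)   ≡⟨ cong Φ (List.++-assoc p (x ∷ y ∷ q) v) ⟩
        Φ (p ++ x ∷ y ∷ q ++ v)     ≈⟨ rel₂ p z x y a b (q ++ v) t eq ⟩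
        Φ (p ++ y ∷ x ∷ q ++ v)     ≡⟨ cong Φ (List.++-assoc p (y ∷ x ∷ q) v) ⟨
        Φ ((p ++ y ∷ x ∷ q) ++ v)   ∎))
      where
      Φ : Word r → V
      Φ u = φ u (z ++ a ∷ b ∷ t) +ᴹ φ u (z ++ b ∷ a ∷ t)

    alt-move : ∀ J z y b {v t} → length z ℕ.+ length y ℕ.< length J →
               alt J (λ u → φ (u ++ v) (z ++ y ++ b ∷ t)) ≈ᴹ
               (-1ℤ ℤ.^ length y) *ₗ alt J (λ u → φ (u ++ v) (z ++ b ∷ y ++ t))
    alt-move J z []      b {v} {t} z+y<J = ≈ᴹ-sym (*ₗ-identityˡ _)
    alt-move J z (c ∷ y) b {v} {t} z+y<J = begin
      alt J (λ u → φ (u ++ v) (z ++ c ∷ y ++ b ∷ t))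
        ≡⟨ cong F (List.∷ʳ-++ z c (y ++ b ∷ t)) ⟨
      alt J (λ u → φ (u ++ v) (z ∷ʳ c ++ y ++ b ∷ t))
        ≈⟨ alt-move J (z ∷ʳ c) y b (subst (ℕ._< length J) eq z+y<J) ⟩
      (-1ℤ ℤ.^ length y) *ₗ alt J (λ u → φ (u ++ v) (z ∷ʳ c ++ b ∷ y ++ t))
        ≡⟨ cong (λ w → (-1ℤ ℤ.^ length y) *ₗ F w) (List.∷ʳ-++ z c (b ∷ y ++ t)) ⟩
      (-1ℤ ℤ.^ length y) *ₗ alt J (λ u → φ (u ++ v) (z ++ c ∷ b ∷ y ++ t))
        ≈⟨ *ₗ-cong refl (alt-swap J z c b (ℕ.≤-trans (s≤s z+1≤) z+y<J)) ⟩
      (-1ℤ ℤ.^ length y) *ₗ -1ℤ *ₗ alt J (λ u → φ (u ++ v) (z ++ b ∷ c ∷ y ++ t))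
        ≈⟨ *ₗ-assoc (-1ℤ ℤ.^ length y) -1ℤ _ ⟨
      ((-1ℤ ℤ.^ length y) ℤ.* -1ℤ) *ₗ alt J (λ u → φ (u ++ v) (z ++ b ∷ c ∷ y ++ t))
        ≈⟨ *ₗ-cong (ℤ.*-comm (-1ℤ ℤ.^ length y) -1ℤ) ≈ᴹ-refl ⟩
      (-1ℤ ℤ.^ suc (length y)) *ₗ alt J (λ u → φ (u ++ v) (z ++ b ∷ c ∷ y ++ t)) ∎
      where
      F : Word r → V
      F w = alt J (λ u → φ (u ++ v) w)
      eq : length z ℕ.+ suc (length y) ≡ length (z ∷ʳ c) ℕ.+ length y
      eq = trans (ℕ.+-suc (length z) (length y)) (cong (ℕ._+ length y) (sym (trans (List.length-++ z) (ℕ.+-comm (length z) 1))))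
      z+1≤ : suc (length z) ℕ.≤ length z ℕ.+ suc (length y)
      z+1≤ = subst (suc (length z) ℕ.≤_) (sym (ℕ.+-suc (length z) (length y))) (s≤s (ℕ.m≤m+n _ _))

    -- The b after K is moved left until it stands next to the b inside K, where `alt-repeat`
    -- applies. All these columns lie below the alternating letters because K is shorter than J.
    alt-∈ : ∀ J K {b v t} → b ∈ K → length K ℕ.< length J →
            alt J (λ u → φ (u ++ v) (K ++ b ∷ t)) ≈ᴹ 0ᴹ
    alt-∈ J K {b} {v} {t} b∈K K<J with z , y , refl ← ∈-∃++ b∈K = begin
      F ((z ++ b ∷ y) ++ b ∷ t)
        ≡⟨ cong F (List.++-assoc z (b ∷ y) (b ∷ t)) ⟩
      F (z ++ b ∷ y ++ b ∷ t)
        ≡⟨ cong F (List.∷ʳ-++ z b (y ++ b ∷ t)) ⟨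
      F (z ∷ʳ b ++ y ++ b ∷ t)
        ≈⟨ alt-move J (z ∷ʳ b) y b (subst (ℕ._< length J) eq K<J) ⟩
      (-1ℤ ℤ.^ length y) *ₗ F (z ∷ʳ b ++ b ∷ y ++ t)
        ≡⟨ cong (λ w → (-1ℤ ℤ.^ length y) *ₗ F w) (List.∷ʳ-++ z b (b ∷ y ++ t)) ⟩
      (-1ℤ ℤ.^ length y) *ₗ F (z ++ b ∷ b ∷ y ++ t)
        ≈⟨ *ₗ-cong refl (alt-repeat J z b (ℕ.≤-trans (s≤s z<K) K<J)) ⟩
      (-1ℤ ℤ.^ length y) *ₗ 0ᴹ
        ≈⟨ *ₗ-zeroʳ _ ⟩
      0ᴹ ∎
      where
      F : Word r → V
      F w = alt J (λ u → φ (u ++ v) w)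
      eq : length (z ++ b ∷ y) ≡ length (z ∷ʳ b) ℕ.+ length y
      eq = trans (cong length (sym (List.∷ʳ-++ z b y))) (List.length-++ (z ∷ʳ b))
      z<K : length z ℕ.< length (z ++ b ∷ y)
      z<K = subst (length z ℕ.<_) (sym (trans (List.length-++-sucʳ z b y) (cong suc (List.length-++ z))))
              (s≤s (ℕ.m≤m+n _ _))

    -- The alternating block only lengthens the prefixes `p` and `p′` by equally many columns.
    -- Sorting arguments thereby become available to the right of the block.
    alt-rightQuantum : ∀ J z → length J ≡ length z →
                       RightQuantum (λ v w → alt J (λ u → φ (u ++ v) (z ++ w)))
    alt-rightQuantum J z J≡z = record
      { rel₁ = λ p p′ x y a q q′ eq → alt-cong J λ u u≡J →
          rel₁′ u p p′ x y a q q′ (trans u≡J J≡z) eq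
      ; rel₂ = λ p p′ x y a b q q′ eq →
          ≈ᴹ-trans (≈ᴹ-sym (alt-+ J _ _)) (≈ᴹ-trans
            (alt-cong J λ u u≡J → rel₂′ u p p′ x y a b q q′ (trans u≡J J≡z) eq)
            (alt-+ J _ _))
      }
      where
      lengths : ∀ u p p′ → length u ≡ length z → length p ≡ length p′ →
                length (u ++ p) ≡ length (z ++ p′)
      lengths u p p′ u≡z p≡p′ =
        trans (List.length-++ u) (trans (cong₂ ℕ._+_ u≡z p≡p′) (sym (List.length-++ z)))
      rel₁′ : ∀ u p p′ x y a q q′ → length u ≡ length z → length p ≡ length p′ →
              φ (u ++ p ++ x ∷ y ∷ q) (z ++ p′ ++ a ∷ a ∷ q′) ≈ᴹ
              φ (u ++ p ++ y ∷ x ∷ q) (z ++ p′ ++ a ∷ a ∷ q′)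
      rel₁′ u p p′ x y a q q′ u≡z p≡p′
        rewrite sym (List.++-assoc u p (x ∷ y ∷ q))
              | sym (List.++-assoc u p (y ∷ x ∷ q))
              | sym (List.++-assoc z p′ (a ∷ a ∷ q′)) =
        rel₁ (u ++ p) (z ++ p′) x y a q q′ (lengths u p p′ u≡z p≡p′)
      rel₂′ : ∀ u p p′ x y a b q q′ → length u ≡ length z → length p ≡ length p′ →
              φ (u ++ p ++ x ∷ y ∷ q) (z ++ p′ ++ a ∷ b ∷ q′) +ᴹ
              φ (u ++ p ++ x ∷ y ∷ q) (z ++ p′ ++ b ∷ a ∷ q′) ≈ᴹ
              φ (u ++ p ++ y ∷ x ∷ q) (z ++ p′ ++ a ∷ b ∷ q′) +ᴹ
              φ (u ++ p ++ y ∷ x ∷ q) (z ++ p′ ++ b ∷ a ∷ q′)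
      rel₂′ u p p′ x y a b q q′ u≡z p≡p′
        rewrite sym (List.++-assoc u p (x ∷ y ∷ q))
              | sym (List.++-assoc u p (y ∷ x ∷ q))
              | sym (List.++-assoc z p′ (a ∷ b ∷ q′))
              | sym (List.++-assoc z p′ (b ∷ a ∷ q′)) =
        rel₂ (u ++ p) (z ++ p′) x y a b q q′ (lengths u p p′ u≡z p≡p′)

  sum-words-head : ∀ L n (f : Word r → V) →
    sum (words L (suc n)) (λ u → sign u *ₗ f u) ≈ᴹ
    sumPicks L (λ p b q → sum (words (p ++ q) n) (λ u → sign (b ∷ u) *ₗ f (b ∷ u)))
  sum-words-head L n f = begin
    sum (words L (suc n)) (λ u → sign u *ₗ f u)
      ≈⟨ sum-words-suc L n _ ⟩
    sum L (λ b → sum (words L n) (λ u → sign (b ∷ u) *ₗ f (b ∷ u)))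
      ≈⟨ sum≈sumPicks L _ ⟩
    sumPicks L (λ _ b _ → sum (words L n) (λ u → sign (b ∷ u) *ₗ f (b ∷ u)))
      ≈⟨ sumPicks-cong L (λ { p b q refl → sum-words-drop p b q n λ {u} b∈u →
           ≈ᴹ-trans (*ₗ-cong (sign-∷-∈ b∈u) ≈ᴹ-refl) (*ₗ-zeroˡ (f (b ∷ u))) }) ⟩
    sumPicks L (λ p b q → sum (words (p ++ q) n) (λ u → sign (b ∷ u) *ₗ f (b ∷ u))) ∎

  -- A word of length |L| in the letters of L is a rearrangement of L, unless
  -- its sign vanishes.
  sum-words-product : ∀ L n → length L ≡ n → ∀ (w : Fin r → ℤ) (f : Word r → V) →
    sum (words L n) (λ u → sign u *ₗ product w u *ₗ f u) ≈ᴹ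
    product w L *ₗ sum (words L n) (λ u → sign u *ₗ f u)
  sum-words-product []      .zero    refl w f = begin
    1ℤ *ₗ 1ℤ *ₗ f [] +ᴹ 0ᴹ     ≈⟨ +ᴹ-congʳ (*ₗ-cong refl (*ₗ-identityˡ _)) ⟩
    1ℤ *ₗ f [] +ᴹ 0ᴹ           ≈⟨ *ₗ-identityˡ _ ⟨
    1ℤ *ₗ (1ℤ *ₗ f [] +ᴹ 0ᴹ)   ∎
  sum-words-product L@(_ ∷ L′) (suc n) L≡n w f = begin
    sum (words L (suc n)) (λ u → sign u *ₗ product w u *ₗ f u)
      ≈⟨ sum-words-head L n _ ⟩
    sumPicks L (λ p b q → sum (words (p ++ q) n) (λ u → sign (b ∷ u) *ₗ product w (b ∷ u) *ₗ f (b ∷ u)))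
      ≈⟨ sumPicks-cong L pick ⟩
    sumPicks L (λ p b q → product w L *ₗ sum (words (p ++ q) n) (λ u → sign (b ∷ u) *ₗ f (b ∷ u)))
      ≈⟨ sumPicks-*ₗ (product w L) L
           (λ p b q → sum (words (p ++ q) n) (λ u → sign (b ∷ u) *ₗ f (b ∷ u))) ⟨
    product w L *ₗ sumPicks L (λ p b q → sum (words (p ++ q) n) (λ u → sign (b ∷ u) *ₗ f (b ∷ u)))
      ≈⟨ *ₗ-cong refl (sum-words-head L n f) ⟨
    product w L *ₗ sum (words L (suc n)) (λ u → sign u *ₗ f u) ∎
    where
    rearr₁ : ∀ s o a b v → (o ℤ.* s) *ₗ (a ℤ.* b) *ₗ v ≈ᴹ s *ₗ b *ₗ (a ℤ.* o) *ₗ v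
    rearr₁ s o a b v = begin
      (o ℤ.* s) *ₗ (a ℤ.* b) *ₗ v      ≈⟨ *ₗ-assoc (o ℤ.* s) (a ℤ.* b) v ⟨
      (o ℤ.* s ℤ.* (a ℤ.* b)) *ₗ v     ≈⟨ *ₗ-cong (lemma s o a b) ≈ᴹ-refl ⟩
      (s ℤ.* (b ℤ.* (a ℤ.* o))) *ₗ v   ≈⟨ *ₗ-assoc s (b ℤ.* (a ℤ.* o)) v ⟩
      s *ₗ (b ℤ.* (a ℤ.* o)) *ₗ v      ≈⟨ *ₗ-cong refl (*ₗ-assoc b (a ℤ.* o) v) ⟩
      s *ₗ b *ₗ (a ℤ.* o) *ₗ v         ∎
      where
      lemma : ∀ s o a b → o ℤ.* s ℤ.* (a ℤ.* b) ≡ s ℤ.* (b ℤ.* (a ℤ.* o))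
      lemma = solve-∀
    rearr₂ : ∀ s o a v → s *ₗ (a ℤ.* o) *ₗ v ≈ᴹ a *ₗ (o ℤ.* s) *ₗ v
    rearr₂ s o a v = begin
      s *ₗ (a ℤ.* o) *ₗ v     ≈⟨ *ₗ-assoc s (a ℤ.* o) v ⟨
      (s ℤ.* (a ℤ.* o)) *ₗ v  ≈⟨ *ₗ-cong (lemma s o a) ≈ᴹ-refl ⟩
      (a ℤ.* (o ℤ.* s)) *ₗ v  ≈⟨ *ₗ-assoc a (o ℤ.* s) v ⟩
      a *ₗ (o ℤ.* s) *ₗ v     ∎
      where
      lemma : ∀ s o a → s ℤ.* (a ℤ.* o) ≡ a ℤ.* (o ℤ.* s)
      lemma = solve-∀
    pick : ∀ p b q → L ≡ p ++ b ∷ q →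
      sum (words (p ++ q) n) (λ u → sign (b ∷ u) *ₗ product w (b ∷ u) *ₗ f (b ∷ u)) ≈ᴹ
      product w L *ₗ sum (words (p ++ q) n) (λ u → sign (b ∷ u) *ₗ f (b ∷ u))
    pick p b q eq = begin
      sum W (λ u → sign (b ∷ u) *ₗ product w (b ∷ u) *ₗ f (b ∷ u))
        -- The weight of b and its orientation factor are moved into the function, so that the
        -- induction hypothesis for arbitrary functions applies to the shorter words.
        ≈⟨ sum-ext (λ u → rearr₁ (sign u) (product (orient b) u) (w b) (product w u) (f (b ∷ u))) W ⟩
      sum W (λ u → sign u *ₗ product w u *ₗ (w b ℤ.* product (orient b) u) *ₗ f (b ∷ u))
        ≈⟨ sum-words-product (p ++ q) n
             (ℕ.suc-injective (trans (sym (List.length-++-sucʳ p b q)) (trans (cong length (sym eq)) L≡n)))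
             w (λ u → (w b ℤ.* product (orient b) u) *ₗ f (b ∷ u)) ⟩
      product w (p ++ q) *ₗ sum W (λ u → sign u *ₗ (w b ℤ.* product (orient b) u) *ₗ f (b ∷ u))
        ≈⟨ *ₗ-cong refl (sum-ext (λ u → rearr₂ (sign u) (product (orient b) u) (w b) (f (b ∷ u))) W) ⟩
      product w (p ++ q) *ₗ sum W (λ u → w b *ₗ sign (b ∷ u) *ₗ f (b ∷ u))
        ≈⟨ *ₗ-cong refl (sum-*ₗ (w b) W _) ⟨
      product w (p ++ q) *ₗ w b *ₗ sum W (λ u → sign (b ∷ u) *ₗ f (b ∷ u))
        ≈⟨ *ₗ-assoc (product w (p ++ q)) (w b) _ ⟨
      (product w (p ++ q) ℤ.* w b) *ₗ sum W (λ u → sign (b ∷ u) *ₗ f (b ∷ u))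
        ≈⟨ *ₗ-cong (trans (ℤ.*-comm (product w (p ++ q)) (w b))
             (trans (sym (product-insert w p b q)) (cong (product w) (sym eq)))) ≈ᴹ-refl ⟩
      product w L *ₗ sum W (λ u → sign (b ∷ u) *ₗ f (b ∷ u)) ∎
      where W = words (p ++ q) n

  -- Laplace expansion along the last column: the orientation factor of the last letter b is
  -- constant on the rearrangements of the other letters and equals the cofactor sign because the
  -- list is increasing.
  alt-laplace : ∀ a K (f : Word r → V) → AllPairs Fin._<_ (a ∷ K) →
           alt (a ∷ K) f ≈ᴹ
           sumPicks (a ∷ K) (λ p b q → (-1ℤ ℤ.^ length q) *ₗ alt (p ++ q) (λ u → f (u ∷ʳ b)))
  alt-laplace a K f inc = begin
    sum (words J (suc n)) (λ u → sign u *ₗ f u)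
      ≈⟨ sum-words-∷ʳ J n _ ⟩
    sum J (λ b → sum (words J n) (λ u → sign (u ∷ʳ b) *ₗ f (u ∷ʳ b)))
      ≈⟨ sum≈sumPicks J _ ⟩
    sumPicks J (λ _ b _ → sum (words J n) (λ u → sign (u ∷ʳ b) *ₗ f (u ∷ʳ b)))
      ≈⟨ sumPicks-cong J pick ⟩
    sumPicks J (λ p b q → (-1ℤ ℤ.^ length q) *ₗ alt (p ++ q) (λ u → f (u ∷ʳ b))) ∎
    where
    J = a ∷ K
    n = length K
    pick : ∀ p b q → J ≡ p ++ b ∷ q →
           sum (words J n) (λ u → sign (u ∷ʳ b) *ₗ f (u ∷ʳ b)) ≈ᴹ
           (-1ℤ ℤ.^ length q) *ₗ alt (p ++ q) (λ u → f (u ∷ʳ b))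
    pick p b q eq = begin
      sum (words J n) (λ u → sign (u ∷ʳ b) *ₗ f (u ∷ʳ b))
        ≡⟨ cong (λ L → sum (words L n) (λ u → sign (u ∷ʳ b) *ₗ f (u ∷ʳ b))) eq ⟩
      sum (words (p ++ b ∷ q) n) (λ u → sign (u ∷ʳ b) *ₗ f (u ∷ʳ b))
        ≈⟨ sum-ext (λ u → ≈ᴹ-trans (*ₗ-cong (sign-∷ʳ u b) ≈ᴹ-refl) (*ₗ-assoc (sign u) (product w u) _))
             (words (p ++ b ∷ q) n) ⟩
      sum (words (p ++ b ∷ q) n) (λ u → sign u *ₗ product w u *ₗ f (u ∷ʳ b))
        -- A second b would contribute the factor `orient b b`, which is 0.
        ≈⟨ sum-words-drop p b q n (λ {u} b∈u → ≈ᴹ-trans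
             (*ₗ-cong refl (≈ᴹ-trans (*ₗ-cong (product-zero w (orient-refl b) b∈u) ≈ᴹ-refl) (*ₗ-zeroˡ _)))
             (*ₗ-zeroʳ (sign u))) ⟩
      sum (words (p ++ q) n) (λ u → sign u *ₗ product w u *ₗ f (u ∷ʳ b))
        ≈⟨ sum-words-product (p ++ q) n (sym n≡) w (λ u → f (u ∷ʳ b)) ⟩
      product w (p ++ q) *ₗ sum (words (p ++ q) n) (λ u → sign u *ₗ f (u ∷ʳ b))
        ≡⟨ cong₂ (λ c k → c *ₗ sum (words (p ++ q) k) (λ u → sign u *ₗ f (u ∷ʳ b)))
             (product-orient p b q (subst (AllPairs Fin._<_) eq inc)) n≡ ⟩
      (-1ℤ ℤ.^ length q) *ₗ alt (p ++ q) (λ u → f (u ∷ʳ b)) ∎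
      where
      w : Fin r → ℤ
      w y = orient y b
      n≡ : n ≡ length (p ++ q)
      n≡ = ℕ.suc-injective (trans (cong length eq) (List.length-++-sucʳ p b q))

-- Non-decreasing rearrangements and bubble sort.

Increasing : Word r → Set
Increasing = AllPairs Fin._≤_

rearrange-↭ : (w : Word r) → rearrange w ↭ w
rearrange-↭ {r} = Sort.sort-↭ (Fin.≤-decTotalOrder r)

rearrange-increasing : (w : Word r) → Increasing (rearrange w)
rearrange-increasing {r} w =
  Sorted.Sorted⇒AllPairs (Fin.≤-totalOrder r) (Sort.sort-↗ (Fin.≤-decTotalOrder r) w)

rearrange-unique : {v w : Word r} → Increasing v → v ↭ w → rearrange w ≡ v
rearrange-unique {r} {v} {w} v↗ v↭w = Pointwise-≡⇒≡
  (Sorted.↗↭↗⇒≋ (Fin.≤-totalOrder r) (Sort.sort-↗ (Fin.≤-decTotalOrder r) w)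
    (Sorted.AllPairs⇒Sorted (Fin.≤-totalOrder r) v↗)
    (↭⇒↭ₛ (↭-trans (rearrange-↭ w) (↭-sym v↭w))))

rearrange-resp-↭ : {v w : Word r} → v ↭ w → rearrange v ≡ rearrange w
rearrange-resp-↭ {w = w} v↭w =
  rearrange-unique (rearrange-increasing w) (↭-trans (rearrange-↭ w) (↭-sym v↭w))

rearrange-length : (w : Word r) → length (rearrange w) ≡ length w
rearrange-length w = Perm.↭-length (rearrange-↭ w)

increasing-min : {a : Fin r} {v : Word r} → Increasing v → a ∈ v → All (a Fin.≤_) v →
                 v ≡ a ∷ drop 1 v
increasing-min v↗           (here refl) a≤v       = refl
increasing-min (c≤v ∷ v↗)   (there a∈v) (a≤c ∷ _) =
  cong (_∷ _) (Fin.≤-antisym (All.lookup c≤v a∈v) a≤c)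

-- This is what makes `drop 1 (rearrange w)` the sorted word with one copy of the least letter a
-- removed.
rearrange-min : {a : Fin r} {w : Word r} → a ∈ w → All (a Fin.≤_) w →
                rearrange w ≡ a ∷ drop 1 (rearrange w)
rearrange-min {w = w} a∈w a≤w =
  increasing-min (rearrange-increasing w) (Perm.∈-resp-↭ (↭-sym (rearrange-↭ w)) a∈w)
    (Perm.All-resp-↭ (↭-sym (rearrange-↭ w)) a≤w)

rearrange-min-∷ : {a : Fin r} {w : Word r} → All (a Fin.≤_) w → rearrange (a ∷ w) ≡ a ∷ rearrange w
rearrange-min-∷ {w = w} a≤w =
  rearrange-unique (Perm.All-resp-↭ (↭-sym (rearrange-↭ w)) a≤w ∷ rearrange-increasing w)
    (prep _ (rearrange-↭ w))

-- A relation acts at a fixed pair of adjacent positions, simultaneously for all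
-- bottom words w.  Hence the top words are sorted by comparators at positions that
-- do not depend on w.
comparator : ℕ → Word r → Word r
comparator _       []          = []
comparator zero    (y ∷ [])    = y ∷ []
comparator zero    (y ∷ z ∷ u) with y Fin.≤? z
... | yes _ = y ∷ z ∷ u
... | no  _ = z ∷ y ∷ u
comparator (suc i) (y ∷ u)     = y ∷ comparator i u

comparator-view : ∀ i (u : Word r) → comparator i u ≡ u ⊎
  ∃[ p ] ∃[ x ] ∃[ y ] ∃[ q ] length p ≡ i × u ≡ p ++ x ∷ y ∷ q × comparator i u ≡ p ++ y ∷ x ∷ q
comparator-view zero    []          = inj₁ refl
comparator-view (suc i) []          = inj₁ refl
comparator-view zero    (y ∷ [])    = inj₁ refl
comparator-view zero    (y ∷ z ∷ u) with y Fin.≤? z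
... | yes _ = inj₁ refl
... | no  _ = inj₂ ([] , y , z , u , refl , refl , refl)
comparator-view (suc i) (y ∷ u)     with comparator-view i u
... | inj₁ eq = inj₁ (cong (y ∷_) eq)
... | inj₂ (p , x , z , q , p≡i , u≡ , eq) =
  inj₂ (y ∷ p , x , z , q , cong suc p≡i , cong (y ∷_) u≡ , cong (y ∷_) eq)

comparator-increasing : ∀ i {u : Word r} → Increasing u → comparator i u ≡ u
comparator-increasing zero    []                       = refl
comparator-increasing (suc i) []                       = refl
comparator-increasing zero    (_ ∷ [])                 = refl
comparator-increasing zero    {y ∷ z ∷ _} ((y≤z ∷ _) ∷ _) with y Fin.≤? z
... | yes _  = refl
... | no y≰z = contradiction y≤z y≰z
comparator-increasing (suc i) (_ ∷ u↗)                 = cong (_ ∷_) (comparator-increasing i u↗)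

-- One pass of bubble sort, comparing the positions j and j + 1 for i ≤ j < i + k.
bubble : ℕ → ℕ → Word r → Word r
bubble i zero    u = u
bubble i (suc k) u = bubble (suc i) k (comparator i u)

bubble-∷ : ∀ i k (y : Fin r) u → bubble (suc i) k (y ∷ u) ≡ y ∷ bubble i k u
bubble-∷ i zero    y u = refl
bubble-∷ i (suc k) y u = bubble-∷ (suc i) k y (comparator i u)

bubble-increasing : ∀ i k {u : Word r} → Increasing u → bubble i k u ≡ u
bubble-increasing i zero    u↗ = refl
bubble-increasing i (suc k) u↗ =
  trans (cong (bubble (suc i) k) (comparator-increasing i u↗)) (bubble-increasing (suc i) k u↗)

-- Only b can be out of place, so a single pass carries it to its position. The comparators after
-- that point meet increasing letters and change nothing.
bubble-insert : ∀ k (b : Fin r) {u} → length u ℕ.≤ k → Increasing u →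
                Increasing (bubble 0 k (b ∷ u)) × bubble 0 k (b ∷ u) ↭ b ∷ u
bubble-insert k b {[]} _ [] rewrite bubble-increasing 0 k {b ∷ []} ([] ∷ []) = [] ∷ [] , ↭-refl
bubble-insert (suc k) b {z ∷ u} (s≤s u≤k) (z≤u ∷ u↗) with b Fin.≤? z
... | yes b≤z = subst Increasing (sym eq) bzu↗ , Perm.↭-reflexive eq
  where
  bzu↗ : Increasing (b ∷ z ∷ u)
  bzu↗ = (b≤z ∷ All.map (Fin.≤-trans b≤z) z≤u) ∷ z≤u ∷ u↗
  eq : bubble 1 k (b ∷ z ∷ u) ≡ b ∷ z ∷ u
  eq = bubble-increasing 1 k bzu↗
... | no b≰z rewrite bubble-∷ 0 k z (b ∷ u) with v↗ , v↭ ← bubble-insert k b u≤k u↗ =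
  Perm.All-resp-↭ (↭-sym v↭) (ℕ.<⇒≤ (ℕ.≰⇒> b≰z) ∷ z≤u) ∷ v↗ ,
  ↭-trans (prep z v↭) (Perm.swap z b ↭-refl)

-- For a outside `xs`, these are the words over `a ∷ xs` in which a occurs. After an initial a the
-- rest is arbitrary, after another letter it must still contain a: the split by first letter that
-- the expansion of `Y` along the bottom word needs.
wordsWith : A → List A → ℕ → List (List A)
wordsWith a xs zero    = []
wordsWith a xs (suc n) =
  map (a ∷_) (words (a ∷ xs) n) ++ concatMap (λ b → map (b ∷_) (wordsWith a xs n)) xs

wordsWith-All : {P : A → Set} {a : A} {xs : List A} → P a → All P xs → ∀ n →
                All (λ w → a ∈ w × All P w × length w ≡ n) (wordsWith a xs n)
wordsWith-All pa pxs zero    = []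
wordsWith-All {a = a} {xs} pa pxs (suc n) = All.++⁺
  (All.map⁺ (All.zipWith (λ (pw , eq) → here refl , pa ∷ pw , cong suc eq)
    (words-All (pa ∷ pxs) n , words-length (a ∷ xs) n)))
  (All.concat⁺ (All.map⁺ (All.map (λ px →
    All.map⁺ (All.map (λ (a∈ , pw , eq) → there a∈ , px ∷ pw , cong suc eq) (wordsWith-All pa pxs n))) pxs)))

rearrange-bubble : {a b : Fin r} {w : Word r} {n : ℕ} →
  a ∈ w → All (a Fin.≤_) w → length w ≡ suc n → a Fin.≤ b →
  drop 1 (rearrange (b ∷ w)) ≡ bubble 0 n (b ∷ drop 1 (rearrange w))
rearrange-bubble {a = a} {b} {w} {n} a∈w a≤w w≡n a≤b =
  cong (drop 1) (rearrange-unique (Perm.All-resp-↭ (↭-sym v↭) (a≤b ∷ a≤d) ∷ v↗)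
    (↭-trans (prep a v↭) (↭-trans (Perm.swap a b ↭-refl)
      (prep b (↭-trans (Perm.↭-reflexive (sym ad)) (rearrange-↭ w))))))
  where
  d = drop 1 (rearrange w)
  ad : rearrange w ≡ a ∷ d
  ad = rearrange-min a∈w a≤w
  ad↗ : Increasing (a ∷ d)
  ad↗ = subst Increasing ad (rearrange-increasing w)
  a≤d = AllPairs.head ad↗
  d≤n : length d ℕ.≤ n
  d≤n = ℕ.≤-reflexive (ℕ.suc-injective (trans (cong length (sym ad)) (trans (rearrange-length w) w≡n)))
  v↗ = proj₁ (bubble-insert n b d≤n (AllPairs.tail ad↗))
  v↭ = proj₂ (bubble-insert n b d≤n (AllPairs.tail ad↗))

-- Independence of sums over bottom words from the order of the top letters.

module Symmetry {m ℓ} (M : LeftModule ℤ.+-*-ring m ℓ) (r : ℕ) where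

  open LeftModule M renaming (Carrierᴹ to V)
  open CommutativeSemigroupProperties
    (CommutativeMonoid.commutativeSemigroup +ᴹ-commutativeMonoid)
    using (interchange)
  open Sums M
  open Alternation M r
  open SetoidReasoning ≈ᴹ-setoid

  sum-wordsWith-suc : ∀ a (xs : List A) n (f : List A → V) →
    sum (wordsWith a xs (suc n)) f ≈ᴹ
    sum (words (a ∷ xs) n) (λ w → f (a ∷ w)) +ᴹ sum xs (λ b → sum (wordsWith a xs n) (λ w → f (b ∷ w)))
  sum-wordsWith-suc a xs n f = ≈ᴹ-trans (sum-++ (map (a ∷_) (words (a ∷ xs) n)) _ f)
    (+ᴹ-cong (sum-map (a ∷_) (words (a ∷ xs) n) f)
      (≈ᴹ-trans (sum-concatMap _ xs f) (sum-ext (λ b → sum-map (b ∷_) (wordsWith a xs n) f) xs)))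

  sum-words-with : ∀ a (xs : List A) n (f : List A → V) →
    sum (words (a ∷ xs) n) f ≈ᴹ sum (wordsWith a xs n) f +ᴹ sum (words xs n) f
  sum-words-with a xs zero    f = ≈ᴹ-sym (+ᴹ-identityˡ _)
  sum-words-with a xs (suc n) f = begin
    sum (words (a ∷ xs) (suc n)) f
      ≈⟨ sum-words-suc (a ∷ xs) n f ⟩
    S +ᴹ sum xs (λ b → sum (words (a ∷ xs) n) (λ w → f (b ∷ w)))
      ≈⟨ +ᴹ-congˡ (≈ᴹ-trans (sum-ext (λ b → sum-words-with a xs n (f ∘ (b ∷_))) xs) (sum-+ xs _ _)) ⟩
    S +ᴹ (sum xs (λ b → sum (wordsWith a xs n) (λ w → f (b ∷ w))) +ᴹ
          sum xs (λ b → sum (words xs n) (λ w → f (b ∷ w))))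
      ≈⟨ +ᴹ-assoc _ _ _ ⟨
    (S +ᴹ sum xs (λ b → sum (wordsWith a xs n) (λ w → f (b ∷ w)))) +ᴹ
      sum xs (λ b → sum (words xs n) (λ w → f (b ∷ w)))
      ≈⟨ +ᴹ-cong (sum-wordsWith-suc a xs n f) (sum-words-suc xs n f) ⟨
    sum (wordsWith a xs (suc n)) f +ᴹ sum (words xs (suc n)) f ∎
    where S = sum (words (a ∷ xs) n) (λ w → f (a ∷ w))

  module _ {φ : Word r → Word r → V} (rq : RightQuantum φ) where
    open RightQuantum rq

    -- Equivalently, `h w` depends only on the multiset of the letters of w, so all rearrangements
    -- of a bottom word share the same top word.
    SwapInvariant : (Word r → Word r) → Set
    SwapInvariant h = ∀ p x y q → h (p ++ x ∷ y ∷ q) ≡ h (p ++ y ∷ x ∷ q)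

    comparator-rel₁ : ∀ i p′ a q′ v → length p′ ≡ i →
      φ (comparator i v) (p′ ++ a ∷ a ∷ q′) ≈ᴹ φ v (p′ ++ a ∷ a ∷ q′)
    comparator-rel₁ i p′ a q′ v p′≡i with comparator-view i v
    ... | inj₁ eq = ≈ᴹ-reflexive (cong (λ u → φ u _) eq)
    ... | inj₂ (p , x , y , q , p≡i , refl , eq) rewrite eq =
      rel₁ p p′ y x a q q′ (trans p≡i (sym p′≡i))

    comparator-rel₂ : ∀ i p′ a b q′ v → length p′ ≡ i →
      φ (comparator i v) (p′ ++ a ∷ b ∷ q′) +ᴹ φ (comparator i v) (p′ ++ b ∷ a ∷ q′) ≈ᴹ
      φ v (p′ ++ a ∷ b ∷ q′) +ᴹ φ v (p′ ++ b ∷ a ∷ q′)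
    comparator-rel₂ i p′ a b q′ v p′≡i with comparator-view i v
    ... | inj₁ eq = ≈ᴹ-reflexive (cong (λ u → φ u _ +ᴹ φ u _) eq)
    ... | inj₂ (p , x , y , q , p≡i , refl , eq) rewrite eq =
      rel₂ p p′ y x a b q q′ (trans p≡i (sym p′≡i))

    difference-zero : ∀ {v w} → v ≈ᴹ w → v +ᴹ -1ℤ *ₗ w ≈ᴹ 0ᴹ
    difference-zero eq = ≈ᴹ-trans (+ᴹ-comm _ _) (neg⇒sum-zero (*ₗ-cong refl (≈ᴹ-sym eq)))

    difference-zero⁻ : ∀ {v w} → v +ᴹ -1ℤ *ₗ w ≈ᴹ 0ᴹ → v ≈ᴹ w
    difference-zero⁻ {v} {w} eq = begin
      v                      ≈⟨ sum-zero⇒neg eq ⟩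
      -1ℤ *ₗ -1ℤ *ₗ w        ≈⟨ *ₗ-assoc -1ℤ -1ℤ w ⟨
      1ℤ *ₗ w                ≈⟨ *ₗ-identityˡ w ⟩
      w                      ∎

    -- The difference of the summands is alternating in w at position i: both orders of the two
    -- letters carry the same top word, so the comparator acts on both alike and `rel₂` applies to
    -- their sum, `rel₁` to equal letters.
    sum-words-comparator : ∀ xs {i n h} → SwapInvariant h → 2 ℕ.+ i ℕ.≤ n →
      sum (words xs n) (λ w → φ (comparator i (h w)) w) ≈ᴹ sum (words xs n) (λ w → φ (h w) w)
    sum-words-comparator xs {i} {n} {h} h-inv i+2≤n = difference-zero⁻ (begin
      sum W (λ w → φ (comparator i (h w)) w) +ᴹ -1ℤ *ₗ sum W (λ w → φ (h w) w)
        ≈⟨ +ᴹ-congˡ (sum-*ₗ -1ℤ W _) ⟩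
      sum W (λ w → φ (comparator i (h w)) w) +ᴹ sum W (λ w → -1ℤ *ₗ φ (h w) w)
        ≈⟨ sum-+ W _ _ ⟨
      sum W (λ w → φ (comparator i (h w)) w +ᴹ -1ℤ *ₗ φ (h w) w)
        ≈⟨ sum-words-alternating xs i+2≤n (record { anti = anti′ ; diag = λ p x q eq →
             difference-zero (comparator-rel₁ i p x q (h (p ++ x ∷ x ∷ q)) eq) }) ⟩
      0ᴹ ∎)
      where
      W = words xs n
      F : Word r → V
      F w = φ (comparator i (h w)) w +ᴹ -1ℤ *ₗ φ (h w) w
      anti′ : ∀ p x y q → length p ≡ i → F (p ++ x ∷ y ∷ q) +ᴹ F (p ++ y ∷ x ∷ q) ≈ᴹ 0ᴹ
      anti′ p x y q eq rewrite h-inv p x y q =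
        ≈ᴹ-trans (interchange _ _ _ _)
        (≈ᴹ-trans (+ᴹ-congˡ (≈ᴹ-sym (*ₗ-distribˡ -1ℤ _ _)))
        (difference-zero (comparator-rel₂ i p x y q (h (p ++ y ∷ x ∷ q)) eq)))

    sum-words-bubble : ∀ xs {i n h} k → SwapInvariant h → i ℕ.+ k ℕ.< n →
      sum (words xs n) (λ w → φ (bubble i k (h w)) w) ≈ᴹ sum (words xs n) (λ w → φ (h w) w)
    sum-words-bubble xs {i} {n} {h} zero    h-inv i+k<n = ≈ᴹ-refl
    sum-words-bubble xs {i} {n} {h} (suc k) h-inv i+k<n = ≈ᴹ-trans
      (sum-words-bubble xs {suc i} {n} {comparator i ∘ h} k
        (λ p x y q → cong (comparator i) (h-inv p x y q)) i+k<n′)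
      (sum-words-comparator xs {h = h} h-inv (ℕ.≤-trans (s≤s (s≤s (ℕ.m≤m+n i k))) i+k<n′))
      where
      i+k<n′ : suc i ℕ.+ k ℕ.< n
      i+k<n′ = subst (ℕ._< n) (ℕ.+-suc i k) i+k<n

    -- The cancellation is available for sums over all words. The words that contain a are reached
    -- as the difference of those over `a ∷ xs` and those over `xs`.
    sum-wordsWith-bubble : ∀ a xs {n h} k → SwapInvariant h → k ℕ.< n →
      sum (wordsWith a xs n) (λ w → φ (bubble 0 k (h w)) w) ≈ᴹ
      sum (wordsWith a xs n) (λ w → φ (h w) w)
    sum-wordsWith-bubble a xs {n} {h} k h-inv k<n =
      GroupProperties.∙-cancelʳ +ᴹ-group _ _ _ (begin
        sum (wordsWith a xs n) (λ w → φ (bubble 0 k (h w)) w) +ᴹ sum (words xs n) (λ w → φ (h w) w)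
          ≈⟨ +ᴹ-congˡ (sum-words-bubble xs {0} k h-inv k<n) ⟨
        sum (wordsWith a xs n) (λ w → φ (bubble 0 k (h w)) w) +ᴹ sum (words xs n) (λ w → φ (bubble 0 k (h w)) w)
          ≈⟨ sum-words-with a xs n _ ⟨
        sum (words (a ∷ xs) n) (λ w → φ (bubble 0 k (h w)) w)
          ≈⟨ sum-words-bubble (a ∷ xs) {0} k h-inv k<n ⟩
        sum (words (a ∷ xs) n) (λ w → φ (h w) w)
          ≈⟨ sum-words-with a xs n _ ⟩
        sum (wordsWith a xs n) (λ w → φ (h w) w) +ᴹ sum (words xs n) (λ w → φ (h w) w) ∎)

    -- One pass of bubble sort leads from the top words with b in front to those with b sorted in,
    -- and it does not change the sum.
    sum-wordsWith-insert : ∀ {a b} xs n → All (a Fin.≤_) xs → a Fin.≤ b →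
      sum (wordsWith a xs n) (λ w → φ (drop 1 (rearrange (b ∷ w))) w) ≈ᴹ
      sum (wordsWith a xs n) (λ w → φ (b ∷ drop 1 (rearrange w)) w)
    sum-wordsWith-insert {a} {b} xs zero    a≤xs a≤b = ≈ᴹ-refl
    sum-wordsWith-insert {a} {b} xs (suc n) a≤xs a≤b = ≈ᴹ-trans
      (sum-cong (All.map (λ { (a∈w , a≤w , eq) →
          ≈ᴹ-reflexive (cong (λ v → φ v _) (rearrange-bubble a∈w a≤w eq a≤b)) })
        (wordsWith-All Fin.≤-refl a≤xs (suc n))))
      (sum-wordsWith-bubble a xs n
        (λ p x y q → cong (λ v → b ∷ drop 1 v)
          (rearrange-resp-↭ (Perm.++⁺ˡ p (Perm.swap x y ↭-refl))))
        (ℕ.n<1+n n))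

-- Signs by inversions and sums over permutations.

product-orient-inv : {x : Fin r} {u : Word r} → All (x ≢_) u →
                     product (orient x) u ≡ -1ℤ ℤ.^ length (filter (Fin._<? x) u)
product-orient-inv []                        = refl
product-orient-inv {x = x} {y ∷ u} (x≢y ∷ x≢u) = head (y Fin.<? x)
  where
  head : Dec (y Fin.< x) → product (orient x) (y ∷ u) ≡ -1ℤ ℤ.^ length (filter (Fin._<? x) (y ∷ u))
  head (yes y<x) rewrite List.filter-accept (Fin._<? x) {xs = u} y<x =
    cong₂ ℤ._*_ (orient-> y<x) (product-orient-inv x≢u)
  head (no y≮x) rewrite List.filter-reject (Fin._<? x) {xs = u} y≮x = trans
    (cong₂ ℤ._*_ (orient-< (Fin.≤∧≢⇒< (ℕ.≮⇒≥ y≮x) x≢y)) (product-orient-inv x≢u)) (ℤ.*-identityˡ _)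

sign-unique : {u : Word r} → Unique u → sign u ≡ -1ℤ ℤ.^ inv u
sign-unique []                        = refl
sign-unique {u = x ∷ u} (x≢u ∷ u!) =
  trans (cong₂ ℤ._*_ (product-orient-inv x≢u) (sign-unique u!))
        (sym (ℤ.^-distribˡ-+-* -1ℤ (length (filter (Fin._<? x) u)) (inv u)))

sign-¬unique : {u : Word r} → ¬ Unique u → sign u ≡ 0ℤ
sign-¬unique {u = []}    ¬u! = contradiction [] ¬u!
sign-¬unique {u = x ∷ u} ¬u! with DecMembership._∈?_ Fin._≟_ x u
... | yes x∈u = sign-∷-∈ x∈u
... | no  x∉u = trans
  (cong (product (orient x) u ℤ.*_) (sign-¬unique λ u! → ¬u! (All.¬Any⇒All¬ u x∉u ∷ u!)))
  (ℤ.*-zeroʳ (product (orient x) u))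

module Permutations {m ℓ} (M : LeftModule ℤ.+-*-ring m ℓ) (r : ℕ) where
  open LeftModule M renaming (Carrierᴹ to V)
  open Sums M
  open Alternation M r

  -- The filter discards exactly the words with a repeated letter, whose `sign` is 0.
  sum-permutations : ∀ J (f : Word r → V) →
    sum (permutations J) (λ σ → (-1ℤ ℤ.^ inv σ) *ₗ f σ) ≈ᴹ alt J f
  sum-permutations J f = go (words J (length J))
    where
    go : ∀ us → sum (filter (UniqueDec.unique? Fin._≟_) us) (λ σ → (-1ℤ ℤ.^ inv σ) *ₗ f σ) ≈ᴹ
                sum us (λ u → sign u *ₗ f u)
    go []       = ≈ᴹ-refl
    go (u ∷ us) with UniqueDec.unique? Fin._≟_ u
    ... | yes u! = +ᴹ-cong (*ₗ-cong (sym (sign-unique u!)) ≈ᴹ-refl) (go us)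
    ... | no ¬u! = ≈ᴹ-trans (go us) (≈ᴹ-sym (≈ᴹ-trans
      (+ᴹ-congʳ (≈ᴹ-trans (*ₗ-cong (sign-¬unique ¬u!) ≈ᴹ-refl) (*ₗ-zeroˡ (f u)))) (+ᴹ-identityˡ _)))

  alt-sum : ∀ J (xs : List A) (f : Word r → A → V) →
            alt J (λ u → sum xs (f u)) ≈ᴹ sum xs (λ x → alt J (λ u → f u x))
  alt-sum J xs f = ≈ᴹ-trans
    (sum-ext (λ u → sum-*ₗ (sign u) xs (f u)) (words J (length J)))
    (sum-swap (words J (length J)) xs _)

-- Expansion and telescoping, and removal of the least letter.

module MacMahon {m ℓ} (M : LeftModule ℤ.+-*-ring m ℓ) (r : ℕ) where

  open LeftModule M renaming (Carrierᴹ to V)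
  open CommutativeSemigroupProperties
    (CommutativeMonoid.commutativeSemigroup +ᴹ-commutativeMonoid)
    using (interchange; x∙yz≈y∙xz)
  open Sums M
  open Alternation M r
  open Symmetry M r
  open Permutations M r
  open SetoidReasoning ≈ᴹ-setoid

  module _ {φ : Word r → Word r → V} (rq : RightQuantum φ) where

    D : Word r → Word r → Word r → V
    D J v w = alt J (λ u → φ (u ++ v) w)

    -- The part of Ferm × Bos over the alphabet xs where Bos contributes words of
    -- length n.
    T : Word r → ℕ → V
    T xs n = sum (sublists xs) λ K → (-1ℤ ℤ.^ length K) *ₗ
      sum (words xs n) λ w → D K (rearrange w) (K ++ w)

    -- P and Q are the terms of T (a ∷ xs) in which a is a letter of w but not of J,
    -- and a letter of J, respectively (Q up to the sign).
    P Q Y Z : Fin r → Word r → ℕ → V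
    P a xs n = sum (sublists xs) λ K → (-1ℤ ℤ.^ length K) *ₗ
      sum (wordsWith a xs n) λ w → D K (rearrange w) (K ++ w)
    Q a xs n = sum (sublists xs) λ K → (-1ℤ ℤ.^ length K) *ₗ
      sum (words (a ∷ xs) n) λ w → D (a ∷ K) (rearrange w) (a ∷ K ++ w)
    Y a xs n = sum (sublists xs) λ K → sum (wordsWith a xs n) λ w →
      D (a ∷ K) (drop 1 (rearrange w)) (K ++ w)
    Z a xs n = sum (sublists xs) λ K → sum (wordsWith a xs n) λ w →
      sumPicks K λ p b q → (-1ℤ ℤ.^ length q) *ₗ
        D (a ∷ p ++ q) (b ∷ drop 1 (rearrange w)) (K ++ w)

    T-∷ : ∀ a xs n → T (a ∷ xs) n ≈ᴹ -1ℤ *ₗ Q a xs n +ᴹ (P a xs n +ᴹ T xs n)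
    T-∷ a xs n = ≈ᴹ-trans (sum-sublists-∷ a xs _) (+ᴹ-cong
      (≈ᴹ-trans (sum-ext (λ K → *ₗ-assoc -1ℤ (-1ℤ ℤ.^ length K) _) (sublists xs))
                (≈ᴹ-sym (sum-*ₗ -1ℤ (sublists xs) _)))
      (≈ᴹ-trans (sum-ext (λ K → ≈ᴹ-trans (*ₗ-cong refl (sum-words-with a xs n _))
                                         (*ₗ-distribˡ (-1ℤ ℤ.^ length K) _ _)) (sublists xs))
                (sum-+ (sublists xs) _ _)))

    module _ {a : Fin r} {xs : Word r} (inc : AllPairs Fin._<_ (a ∷ xs)) where

      a≤xs : All (a Fin.≤_) xs
      a≤xs = All.map ℕ.<⇒≤ (AllPairs.head inc)

      -- The last alternating letter is a or some b in K. If it is a, it heads the remaining top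
      -- word and completes it to the sorted w, with cofactor sign from all of K above it; the other
      -- cofactors form `Z`.
      expand-top : ∀ n → Y a xs n ≈ᴹ P a xs n +ᴹ Z a xs n
      expand-top n = begin
        Y a xs n
          ≈⟨ sum-cong (All.zipWith (λ (a<K , K↗) → sum-cong (All.map (λ (a∈w , a≤w , _) →
               expand (a<K ∷ K↗) (rearrange-min a∈w a≤w)) (wordsWith-All Fin.≤-refl a≤xs n)))
             (sublists-All (AllPairs.head inc) , sublists-AllPairs (AllPairs.tail inc))) ⟩
        sum S (λ K → sum W λ w → (-1ℤ ℤ.^ length K) *ₗ D K (rearrange w) (K ++ w) +ᴹ picks K w)
          ≈⟨ sum-ext (λ K → ≈ᴹ-trans (sum-+ W _ _) (+ᴹ-congʳ (≈ᴹ-sym (sum-*ₗ (-1ℤ ℤ.^ length K) W _)))) S ⟩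
        sum S (λ K → (-1ℤ ℤ.^ length K) *ₗ sum W (λ w → D K (rearrange w) (K ++ w)) +ᴹ sum W (picks K))
          ≈⟨ sum-+ S _ _ ⟩
        P a xs n +ᴹ Z a xs n ∎
        where
        S = sublists xs
        W = wordsWith a xs n
        picks : Word r → Word r → V
        picks K w = sumPicks K λ p b q → (-1ℤ ℤ.^ length q) *ₗ
          D (a ∷ p ++ q) (b ∷ drop 1 (rearrange w)) (K ++ w)
        expand : ∀ {K w} → AllPairs Fin._<_ (a ∷ K) → rearrange w ≡ a ∷ drop 1 (rearrange w) →
                 D (a ∷ K) (drop 1 (rearrange w)) (K ++ w) ≈ᴹ
                 (-1ℤ ℤ.^ length K) *ₗ D K (rearrange w) (K ++ w) +ᴹ picks K w
        expand {K} {w} aK↗ eq = begin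
          D (a ∷ K) d (K ++ w)
            ≈⟨ alt-laplace a K (λ u → φ (u ++ d) (K ++ w)) aK↗ ⟩
          sumPicks (a ∷ K) (λ p b q → (-1ℤ ℤ.^ length q) *ₗ alt (p ++ q) (λ u → φ (u ∷ʳ b ++ d) (K ++ w)))
            ≈⟨ sumPicks-cong (a ∷ K) (λ p b q _ → *ₗ-cong (refl {x = -1ℤ ℤ.^ length q}) (alt-cong (p ++ q) λ u _ →
                 ≈ᴹ-reflexive (cong (λ v → φ v (K ++ w)) (List.∷ʳ-++ u b d)))) ⟩
          (-1ℤ ℤ.^ length K) *ₗ D K (a ∷ d) (K ++ w) +ᴹ picks K w
            ≡⟨ cong (λ v → (-1ℤ ℤ.^ length K) *ₗ D K v (K ++ w) +ᴹ picks K w) eq ⟨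
          (-1ℤ ℤ.^ length K) *ₗ D K (rearrange w) (K ++ w) +ᴹ picks K w ∎
          where d = drop 1 (rearrange w)

      -- If w begins with a, this a is moved left past K, which produces the sign in `Q`. If it
      -- begins with another letter b, the top word is unsorted so that b stands in front. The terms
      -- with b in K vanish; otherwise b is a distinguished letter of the larger set, and moving it
      -- to its place gives the sign that the Laplace expansion attaches to `Z`.
      expand-bottom : ∀ n → Y a xs (suc n) ≈ᴹ Q a xs n +ᴹ Z a xs n
      expand-bottom n = begin
        Y a xs (suc n)
          ≈⟨ sum-ext (λ K → sum-wordsWith-suc a xs n _) S ⟩
        sum S (λ K → sum W (λ w → D (a ∷ K) (drop 1 (rearrange (a ∷ w))) (K ++ a ∷ w)) +ᴹ
          sum xs (λ b → sum Wᵃ (λ w → D (a ∷ K) (drop 1 (rearrange (b ∷ w))) (K ++ b ∷ w))))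
          ≈⟨ sum-+ S _ _ ⟩
        sum S (λ K → sum W (λ w → D (a ∷ K) (drop 1 (rearrange (a ∷ w))) (K ++ a ∷ w))) +ᴹ
          sum S (λ K → sum xs (λ b → sum Wᵃ (λ w → D (a ∷ K) (drop 1 (rearrange (b ∷ w))) (K ++ b ∷ w))))
          ≈⟨ +ᴹ-cong (sum-ext first S) (sum-ext (λ K → sum-cong (All.map (symmetrize K) a≤xs)) S) ⟩
        Q a xs n +ᴹ sum S (λ K → sum xs (F K))
          ≈⟨ +ᴹ-congˡ (sublists-pick xs F vanish) ⟩
        Q a xs n +ᴹ sum S (λ K → sumPicks K (λ p b q → F (p ++ q) b))
          ≈⟨ +ᴹ-congˡ (sum-ext rest S) ⟩
        Q a xs n +ᴹ Z a xs n ∎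
        where
        S = sublists xs
        W = words (a ∷ xs) n
        Wᵃ = wordsWith a xs n
        F : Word r → Fin r → V
        F K b = sum Wᵃ (λ w → D (a ∷ K) (b ∷ drop 1 (rearrange w)) (K ++ b ∷ w))
        first : ∀ K → sum W (λ w → D (a ∷ K) (drop 1 (rearrange (a ∷ w))) (K ++ a ∷ w)) ≈ᴹ
                (-1ℤ ℤ.^ length K) *ₗ sum W (λ w → D (a ∷ K) (rearrange w) (a ∷ K ++ w))
        first K = ≈ᴹ-trans
          (sum-cong (All.map (λ {w} a≤w → ≈ᴹ-trans
            (≈ᴹ-reflexive (cong (λ v → D (a ∷ K) (drop 1 v) (K ++ a ∷ w)) (rearrange-min-∷ a≤w)))
            (alt-move rq (a ∷ K) [] K a (ℕ.n<1+n _))) (words-All (Fin.≤-refl ∷ a≤xs) n)))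
          (≈ᴹ-sym (sum-*ₗ (-1ℤ ℤ.^ length K) W _))
        symmetrize : ∀ K {b} → a Fin.≤ b →
          sum Wᵃ (λ w → D (a ∷ K) (drop 1 (rearrange (b ∷ w))) (K ++ b ∷ w)) ≈ᴹ F K b
        symmetrize K {b} a≤b = begin
          sum Wᵃ (λ w → D (a ∷ K) (drop 1 (rearrange (b ∷ w))) (K ++ b ∷ w))
            -- The block `a ∷ K` on top is one letter longer than K. Hence b belongs to its last
            -- column, and the remaining top word stands exactly above w.
            ≈⟨ sum-ext (λ w → ≈ᴹ-reflexive (cong (D (a ∷ K) _) (sym (List.∷ʳ-++ K b w)))) Wᵃ ⟩
          sum Wᵃ (λ w → D (a ∷ K) (drop 1 (rearrange (b ∷ w))) (K ∷ʳ b ++ w))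
            ≈⟨ sum-wordsWith-insert (alt-rightQuantum rq (a ∷ K) (K ∷ʳ b)
                 (sym (trans (List.length-++ K) (ℕ.+-comm (length K) 1)))) xs n a≤xs a≤b ⟩
          sum Wᵃ (λ w → D (a ∷ K) (b ∷ drop 1 (rearrange w)) (K ∷ʳ b ++ w))
            ≈⟨ sum-ext (λ w → ≈ᴹ-reflexive (cong (D (a ∷ K) _) (List.∷ʳ-++ K b w))) Wᵃ ⟩
          F K b ∎
        vanish : ∀ {K b} → b ∈ K → F K b ≈ᴹ 0ᴹ
        vanish {K} b∈K = sum-zero (All.universal (λ w → alt-∈ rq (a ∷ K) K b∈K (ℕ.n<1+n _)) Wᵃ)
        rest : ∀ K → sumPicks K (λ p b q → F (p ++ q) b) ≈ᴹ
               sum Wᵃ (λ w → sumPicks K λ p b q → (-1ℤ ℤ.^ length q) *ₗ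
                 D (a ∷ p ++ q) (b ∷ drop 1 (rearrange w)) (K ++ w))
        rest K = ≈ᴹ-trans
          (sumPicks-cong K λ { p b q refl → sum-ext (λ w → move p b q w (b ∷ drop 1 (rearrange w))) Wᵃ })
          (sumPicks-sum K Wᵃ λ w p b q → (-1ℤ ℤ.^ length q) *ₗ
             D (a ∷ p ++ q) (b ∷ drop 1 (rearrange w)) (K ++ w))
          where
          move : ∀ p b q w v → D (a ∷ p ++ q) v ((p ++ q) ++ b ∷ w) ≈ᴹ
                 (-1ℤ ℤ.^ length q) *ₗ D (a ∷ p ++ q) v ((p ++ b ∷ q) ++ w)
          move p b q w v rewrite List.++-assoc p q (b ∷ w) | List.++-assoc p (b ∷ q) w =
            alt-move rq (a ∷ p ++ q) p q b (s≤s (ℕ.≤-reflexive (sym (List.length-++ p))))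

      Y-zero : Y a xs 0 ≈ᴹ 0ᴹ
      Y-zero = sum-zero (All.universal (λ _ → ≈ᴹ-refl) (sublists xs))

      T-step : ∀ n → T (a ∷ xs) n +ᴹ Y a xs (suc n) ≈ᴹ T xs n +ᴹ Y a xs n
      T-step n = begin
        T (a ∷ xs) n +ᴹ Y a xs (suc n)
          ≈⟨ +ᴹ-cong (T-∷ a xs n) (expand-bottom n) ⟩
        (-1ℤ *ₗ Q a xs n +ᴹ (P a xs n +ᴹ T xs n)) +ᴹ (Q a xs n +ᴹ Z a xs n)
          ≈⟨ interchange _ _ _ _ ⟩
        (-1ℤ *ₗ Q a xs n +ᴹ Q a xs n) +ᴹ ((P a xs n +ᴹ T xs n) +ᴹ Z a xs n)
          ≈⟨ +ᴹ-cong (neg⇒sum-zero ≈ᴹ-refl) (+ᴹ-congʳ (+ᴹ-comm _ _)) ⟩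
        0ᴹ +ᴹ ((T xs n +ᴹ P a xs n) +ᴹ Z a xs n)
          ≈⟨ +ᴹ-identityˡ _ ⟩
        (T xs n +ᴹ P a xs n) +ᴹ Z a xs n
          ≈⟨ +ᴹ-assoc _ _ _ ⟩
        T xs n +ᴹ (P a xs n +ᴹ Z a xs n)
          ≈⟨ +ᴹ-congˡ (expand-top n) ⟨
        T xs n +ᴹ Y a xs n ∎

      -- The lower boundary is an empty sum, as a does not occur in the empty word. The upper one,
      -- `Y a xs N`, stays and is removed by truncation.
      T-telescope : ∀ N → sum (downFrom N) (T (a ∷ xs)) +ᴹ Y a xs N ≈ᴹ sum (downFrom N) (T xs)
      T-telescope zero    = ≈ᴹ-trans (+ᴹ-identityˡ _) Y-zero
      T-telescope (suc N) = begin
        (T (a ∷ xs) N +ᴹ sum (downFrom N) (T (a ∷ xs))) +ᴹ Y a xs (suc N)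
          ≈⟨ +ᴹ-congʳ (+ᴹ-comm _ _) ⟩
        (sum (downFrom N) (T (a ∷ xs)) +ᴹ T (a ∷ xs) N) +ᴹ Y a xs (suc N)
          ≈⟨ +ᴹ-assoc _ _ _ ⟩
        sum (downFrom N) (T (a ∷ xs)) +ᴹ (T (a ∷ xs) N +ᴹ Y a xs (suc N))
          ≈⟨ +ᴹ-congˡ (T-step N) ⟩
        sum (downFrom N) (T (a ∷ xs)) +ᴹ (T xs N +ᴹ Y a xs N)
          ≈⟨ x∙yz≈y∙xz _ _ _ ⟩
        T xs N +ᴹ (sum (downFrom N) (T (a ∷ xs)) +ᴹ Y a xs N)
          ≈⟨ +ᴹ-congˡ (T-telescope N) ⟩
        T xs N +ᴹ sum (downFrom N) (T xs) ∎

    module _ {N : ℕ} (φ-zero : ∀ u w → N ℕ.≤ length u → N ℕ.≤ length w → φ u w ≈ᴹ 0ᴹ) where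

      Y-vanish : ∀ {a xs} → AllPairs Fin._<_ (a ∷ xs) → Y a xs N ≈ᴹ 0ᴹ
      Y-vanish {a} {xs} inc = sum-zero (All.universal (λ K → sum-zero (All.map
        (λ (_ , _ , w≡N) → term K w≡N) (wordsWith-All Fin.≤-refl (a≤xs inc) N))) (sublists xs))
        where
        term : ∀ K {w} → length w ≡ N → D (a ∷ K) (drop 1 (rearrange w)) (K ++ w) ≈ᴹ 0ᴹ
        term K {w} w≡N = ≈ᴹ-trans (alt-cong (a ∷ K) λ u u≡ → φ-zero _ _ (top u u≡) bottom)
          (sum-zero {f = λ u → sign u *ₗ 0ᴹ}
            (All.universal (λ u → *ₗ-zeroʳ (sign u)) (words (a ∷ K) (suc (length K)))))
          where
          d = drop 1 (rearrange w)
          N≤w : N ℕ.≤ length w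
          N≤w = ℕ.≤-reflexive (sym w≡N)
          bottom : N ℕ.≤ length (K ++ w)
          bottom = subst (N ℕ.≤_) (sym (List.length-++ K)) (ℕ.≤-trans N≤w (ℕ.m≤n+m _ (length K)))
          -- Dropping loses at most one letter, which the letter a of the block `a ∷ K` makes up
          -- for.
          N≤d : N ℕ.≤ suc (length d)
          N≤d = subst (N ℕ.≤_)
            (cong suc (trans (cong (ℕ._∸ 1) (sym (rearrange-length w))) (sym (List.length-drop 1 (rearrange w)))))
            (ℕ.≤-trans N≤w (ℕ.m≤n+m∸n (length w) 1))
          top : ∀ u → length u ≡ suc (length K) → N ℕ.≤ length (u ++ d)
          top u u≡ = subst (N ℕ.≤_)
            (sym (trans (List.length-++ u) (cong (ℕ._+ length d) u≡)))
            (ℕ.≤-trans N≤d (s≤s (ℕ.m≤n+m (length d) (length K))))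

      sum-T-reduce : ∀ {xs} → AllPairs Fin._<_ xs → sum (downFrom N) (T xs) ≈ᴹ sum (downFrom N) (T [])
      sum-T-reduce []               = ≈ᴹ-refl
      sum-T-reduce {a ∷ xs} inc@(_ ∷ xs↗) = begin
        sum (downFrom N) (T (a ∷ xs))                ≈⟨ +ᴹ-identityʳ _ ⟨
        sum (downFrom N) (T (a ∷ xs)) +ᴹ 0ᴹ          ≈⟨ +ᴹ-congˡ (Y-vanish inc) ⟨
        sum (downFrom N) (T (a ∷ xs)) +ᴹ Y a xs N    ≈⟨ T-telescope inc N ⟩
        sum (downFrom N) (T xs)                      ≈⟨ sum-T-reduce xs↗ ⟩
        sum (downFrom N) (T [])                      ∎

    sum-T-[] : ∀ n → sum (downFrom (suc n)) (T []) ≈ᴹ φ [] []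
    sum-T-[] zero = begin
      (1ℤ *ₗ ((1ℤ *ₗ φ (rearrange []) [] +ᴹ 0ᴹ) +ᴹ 0ᴹ) +ᴹ 0ᴹ) +ᴹ 0ᴹ
        ≈⟨ ≈ᴹ-trans (+ᴹ-identityʳ _) (≈ᴹ-trans (+ᴹ-identityʳ _) (≈ᴹ-trans (*ₗ-identityˡ _)
             (≈ᴹ-trans (+ᴹ-identityʳ _) (≈ᴹ-trans (+ᴹ-identityʳ _) (*ₗ-identityˡ _))))) ⟩
      φ (rearrange []) []
        ≡⟨ cong (λ v → φ v []) (rearrange-unique [] (↭-refl {x = []})) ⟩
      φ [] [] ∎
    sum-T-[] (suc n) = begin
      (1ℤ *ₗ 0ᴹ +ᴹ 0ᴹ) +ᴹ sum (downFrom (suc n)) (T [])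
        ≈⟨ +ᴹ-congʳ (≈ᴹ-trans (+ᴹ-identityʳ _) (*ₗ-zeroʳ 1ℤ)) ⟩
      0ᴹ +ᴹ sum (downFrom (suc n)) (T [])
        ≈⟨ +ᴹ-identityˡ _ ⟩
      sum (downFrom (suc n)) (T [])
        ≈⟨ sum-T-[] n ⟩
      φ [] [] ∎

    -- Here ψ stands for the product of a biword with Bos. A module has no multiplication, so the
    -- expansion of this product is a hypothesis. The cut at `suc n` keeps the term of degree 0,
    -- which becomes the right-hand side.
    macMahon : ∀ {n} → (∀ u w → suc n ℕ.≤ length u → suc n ℕ.≤ length w → φ u w ≈ᴹ 0ᴹ) →
      ∀ {xs} → AllPairs Fin._<_ xs → (ψ : Word r → Word r → V) →
      (∀ σ J → length σ ≡ length J → ψ σ J ≈ᴹ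
        sum (downFrom (suc n)) λ k → sum (words xs k) λ w → φ (σ ++ rearrange w) (J ++ w)) →
      sum (sublists xs) (λ J → (-1ℤ ℤ.^ length J) *ₗ
        sum (permutations J) λ σ → (-1ℤ ℤ.^ inv σ) *ₗ ψ σ J) ≈ᴹ φ [] []
    macMahon {n} φ-zero {xs} xs↗ ψ ψ≈ = begin
      sum S (λ J → (-1ℤ ℤ.^ length J) *ₗ sum (permutations J) (λ σ → (-1ℤ ℤ.^ inv σ) *ₗ ψ σ J))
        ≈⟨ sum-ext (λ J → *ₗ-cong refl (≈ᴹ-trans (sum-permutations J (λ σ → ψ σ J))
             (≈ᴹ-trans (alt-cong J (λ σ → ψ≈ σ J)) (≈ᴹ-trans (alt-sum J (downFrom (suc n)) _)
             (sum-ext (λ k → alt-sum J (words xs k) _) (downFrom (suc n))))))) S ⟩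
      sum S (λ J → (-1ℤ ℤ.^ length J) *ₗ sum (downFrom (suc n)) λ k → sum (words xs k) λ w →
        D J (rearrange w) (J ++ w))
        ≈⟨ sum-ext (λ J → sum-*ₗ (-1ℤ ℤ.^ length J) (downFrom (suc n)) _) S ⟩
      sum S (λ J → sum (downFrom (suc n)) λ k → (-1ℤ ℤ.^ length J) *ₗ sum (words xs k) λ w →
        D J (rearrange w) (J ++ w))
        ≈⟨ sum-swap S (downFrom (suc n)) _ ⟩
      sum (downFrom (suc n)) (T xs)
        ≈⟨ sum-T-reduce φ-zero xs↗ ⟩
      sum (downFrom (suc n)) (T [])
        ≈⟨ sum-T-[] n ⟩
      φ [] [] ∎
      where S = sublists xs

-- The convolution product of formal sums.

private
  module ΣZ = Sums (TensorUnit.leftModule {R = ℤ.+-*-ring})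

∑-apply : ∀ (xs : List A) (f : A → Series r) α → ∑ xs f α ≡ ΣZ.sum xs (λ x → f x α)
∑-apply []       f α = refl
∑-apply (x ∷ xs) f α = cong (λ c → f x α ℤ.+ c) (∑-apply xs f α)

∑-cong : ∀ (xs : List A) {f g : A → Series r} → (∀ x → f x ≗ g x) → ∑ xs f ≗ ∑ xs g
∑-cong []       f≗g α = refl
∑-cong (x ∷ xs) f≗g α = cong₂ ℤ._+_ (f≗g x α) (∑-cong xs f≗g α)

⟨⟩-refl : (α : Biword r) → ⟨ α ⟩ α ≡ 1ℤ
⟨⟩-refl α with α ≟ᵇ α
... | yes _   = refl
... | no  α≢α = contradiction refl α≢α

⟨⟩-≢ : {α β : Biword r} → α ≢ β → ⟨ α ⟩ β ≡ 0ℤ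
⟨⟩-≢ {α = α} {β} α≢β with α ≟ᵇ β
... | yes α≡β = contradiction α≡β α≢β
... | no  _   = refl

summand : Series r → Series r → Biword r × Biword r → ℤ
summand f g (β , γ) = f β ℤ.* g γ

⊛-∷ : (f g : Series r) → ∀ x α → (f ⊛ g) (x ∷ α) ≡ f [] ℤ.* g (x ∷ α) ℤ.+ ((f ∘ (x ∷_)) ⊛ g) α
⊛-∷ f g x α = cong (λ c → f [] ℤ.* g (x ∷ α) ℤ.+ c) (ΣZ.sum-map (map₁ (x ∷_)) (splits α) (summand f g))

⊛-congˡ : {f f′ : Series r} (g : Series r) → f ≗ f′ → f ⊛ g ≗ f′ ⊛ g
⊛-congˡ g f≗f′ α = ΣZ.sum-ext (λ (β , γ) → cong (ℤ._* g γ) (f≗f′ β)) (splits α)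

-- This lets Bos be replaced by a finite partial sum inside a product; only then does linearity in
-- the second factor apply.
⊛-congʳ-≤ : (f : Series r) {g g′ : Series r} → ∀ α →
            (∀ γ → length γ ℕ.≤ length α → g γ ≡ g′ γ) → (f ⊛ g) α ≡ (f ⊛ g′) α
⊛-congʳ-≤ f []      g≡g′ = cong (λ c → f [] ℤ.* c ℤ.+ 0ℤ) (g≡g′ [] z≤n)
⊛-congʳ-≤ f {g} {g′} (x ∷ α) g≡g′ = trans (⊛-∷ f g x α) (trans
  (cong₂ (λ c d → f [] ℤ.* c ℤ.+ d) (g≡g′ (x ∷ α) ℕ.≤-refl)
    (⊛-congʳ-≤ (f ∘ (x ∷_)) α (λ γ γ≤α → g≡g′ γ (ℕ.m≤n⇒m≤1+n γ≤α))))
  (sym (⊛-∷ f g′ x α)))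

⊛-∑ˡ : ∀ (xs : List A) (f : A → Series r) g → (∑ xs f) ⊛ g ≗ ∑ xs (λ x → f x ⊛ g)
⊛-∑ˡ xs f g α = begin
  ΣZ.sum (splits α) (λ (β , γ) → ∑ xs f β ℤ.* g γ)
    ≡⟨ ΣZ.sum-ext (λ (β , γ) → trans (cong (ℤ._* g γ) (∑-apply xs f β)) (trans (ℤ.*-comm _ (g γ))
         (trans (ΣZ.sum-*ₗ (g γ) xs (λ x → f x β)) (ΣZ.sum-ext (λ x → ℤ.*-comm (g γ) (f x β)) xs)))) (splits α) ⟩
  ΣZ.sum (splits α) (λ (β , γ) → ΣZ.sum xs (λ x → f x β ℤ.* g γ))
    ≡⟨ ΣZ.sum-swap (splits α) xs (λ p x → summand (f x) g p) ⟩
  ΣZ.sum xs (λ x → (f x ⊛ g) α)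
    ≡⟨ ∑-apply xs (λ x → f x ⊛ g) α ⟨
  ∑ xs (λ x → f x ⊛ g) α ∎
  where open ≡-Reasoning

⊛-∑ʳ : ∀ f (xs : List A) (g : A → Series r) → f ⊛ (∑ xs g) ≗ ∑ xs (λ x → f ⊛ g x)
⊛-∑ʳ f xs g α = begin
  ΣZ.sum (splits α) (λ (β , γ) → f β ℤ.* ∑ xs g γ)
    ≡⟨ ΣZ.sum-ext (λ (β , γ) → trans (cong (f β ℤ.*_) (∑-apply xs g γ))
         (ΣZ.sum-*ₗ (f β) xs (λ x → g x γ))) (splits α) ⟩
  ΣZ.sum (splits α) (λ (β , γ) → ΣZ.sum xs (λ x → f β ℤ.* g x γ))
    ≡⟨ ΣZ.sum-swap (splits α) xs (λ p x → summand f (g x) p) ⟩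
  ΣZ.sum xs (λ x → (f ⊛ g x) α)
    ≡⟨ ∑-apply xs (λ x → f ⊛ g x) α ⟨
  ∑ xs (λ x → f ⊛ g x) α ∎
  where open ≡-Reasoning

⊛-·ˡ : ∀ c (f g : Series r) → (c · f) ⊛ g ≗ c · (f ⊛ g)
⊛-·ˡ c f g α = trans (ΣZ.sum-ext (λ (β , γ) → ℤ.*-assoc c (f β) (g γ)) (splits α))
  (sym (ΣZ.sum-*ₗ c (splits α) (summand f g)))

⊛-⊕ˡ : (f g h : Series r) → (f ⊕ g) ⊛ h ≗ f ⊛ h ⊕ g ⊛ h
⊛-⊕ˡ f g h α = trans (ΣZ.sum-ext (λ (β , γ) → ℤ.*-distribʳ-+ (h γ) (f β) (g β)) (splits α))
  (ΣZ.sum-+ (splits α) (summand f h) (summand g h))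

⊛-⊕ʳ : (f g h : Series r) → f ⊛ (g ⊕ h) ≗ f ⊛ g ⊕ f ⊛ h
⊛-⊕ʳ f g h α = trans (ΣZ.sum-ext (λ (β , γ) → ℤ.*-distribˡ-+ (f β) (g γ) (h γ)) (splits α))
  (ΣZ.sum-+ (splits α) (summand f g) (summand f h))

sum-⊖ : ∀ (ps : List A) (s t : A → ℤ) →
        ΣZ.sum ps (λ p → s p ℤ.+ -1ℤ ℤ.* t p) ≡ ΣZ.sum ps s ℤ.- ΣZ.sum ps t
sum-⊖ ps s t = trans (ΣZ.sum-+ ps s (λ p → -1ℤ ℤ.* t p))
  (cong (λ c → ΣZ.sum ps s ℤ.+ c) (trans (sym (ΣZ.sum-*ₗ -1ℤ ps t)) (ℤ.-1*i≡-i _)))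

⊛-⊖ˡ : (f g h : Series r) → (f ⊖ g) ⊛ h ≗ f ⊛ h ⊖ g ⊛ h
⊛-⊖ˡ f g h α = trans (ΣZ.sum-ext (λ (β , γ) → lemma (f β) (g β) (h γ)) (splits α))
  (sum-⊖ (splits α) (summand f h) (summand g h))
  where
  lemma : ∀ a b c → (a ℤ.- b) ℤ.* c ≡ a ℤ.* c ℤ.+ -1ℤ ℤ.* (b ℤ.* c)
  lemma = solve-∀

⊛-⊖ʳ : (f g h : Series r) → f ⊛ (g ⊖ h) ≗ f ⊛ g ⊖ f ⊛ h
⊛-⊖ʳ f g h α = trans (ΣZ.sum-ext (λ (β , γ) → lemma (f β) (g γ) (h γ)) (splits α))
  (sum-⊖ (splits α) (summand f g) (summand f h))
  where
  lemma : ∀ a b c → a ℤ.* (b ℤ.- c) ≡ a ℤ.* b ℤ.+ -1ℤ ℤ.* (a ℤ.* c)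
  lemma = solve-∀

⊛-zeroˡ : {f : Series r} (g : Series r) → (∀ β → f β ≡ 0ℤ) → ∀ α → (f ⊛ g) α ≡ 0ℤ
⊛-zeroˡ g f≡0 α = ΣZ.sum-zero
  (All.universal (λ (β , γ) → trans (cong (ℤ._* g γ) (f≡0 β)) (ℤ.*-zeroˡ (g γ))) (splits α))

𝟙-⊛ : (g : Series r) → 𝟙 ⊛ g ≗ g
𝟙-⊛ g []      = trans (ℤ.+-identityʳ _) (ℤ.*-identityˡ (g []))
𝟙-⊛ g (x ∷ α) = trans (⊛-∷ 𝟙 g x α) (trans
  (cong₂ ℤ._+_ (ℤ.*-identityˡ (g (x ∷ α))) (⊛-zeroˡ g (λ _ → refl) α)) (ℤ.+-identityʳ _))

⟨⟩-⊛ : (α β : Biword r) → ⟨ α ⟩ ⊛ ⟨ β ⟩ ≗ ⟨ α ++ β ⟩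
⟨⟩-⊛ []      β γ       = 𝟙-⊛ ⟨ β ⟩ γ
⟨⟩-⊛ (x ∷ α) β []      = trans (ℤ.+-identityʳ _) (ℤ.*-zeroˡ (⟨ β ⟩ []))
⟨⟩-⊛ (x ∷ α) β (y ∷ γ) = trans (⊛-∷ ⟨ x ∷ α ⟩ ⟨ β ⟩ y γ)
  (trans (cong (ℤ._+ ((⟨ x ∷ α ⟩ ∘ (y ∷_)) ⊛ ⟨ β ⟩) γ) (ℤ.*-zeroˡ (⟨ β ⟩ (y ∷ γ))))
  (trans (ℤ.+-identityˡ _) (head (Product.≡-dec Fin._≟_ Fin._≟_ x y))))
  where
  bracket-∷ : ∀ x (α γ : Biword _) → ⟨ x ∷ α ⟩ (x ∷ γ) ≡ ⟨ α ⟩ γ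
  bracket-∷ x α γ = by-cases (α ≟ᵇ γ)
    where
    by-cases : Dec (α ≡ γ) → ⟨ x ∷ α ⟩ (x ∷ γ) ≡ ⟨ α ⟩ γ
    by-cases (yes refl) = trans (⟨⟩-refl (x ∷ α)) (sym (⟨⟩-refl α))
    by-cases (no  α≢γ)  = trans (⟨⟩-≢ {α = x ∷ α} {x ∷ γ} (α≢γ ∘ List.∷-injectiveʳ)) (sym (⟨⟩-≢ α≢γ))
  head : Dec (x ≡ y) → ((⟨ x ∷ α ⟩ ∘ (y ∷_)) ⊛ ⟨ β ⟩) γ ≡ ⟨ x ∷ α ++ β ⟩ (y ∷ γ)
  head (yes refl) = trans (⊛-congˡ ⟨ β ⟩ (bracket-∷ x α) γ)
    (trans (⟨⟩-⊛ α β γ) (sym (bracket-∷ x (α ++ β) γ)))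
  head (no  x≢y)  = trans (⊛-zeroˡ ⟨ β ⟩ (λ δ → ⟨⟩-≢ {α = x ∷ α} {y ∷ δ} (x≢y ∘ List.∷-injectiveˡ)) γ)
    (sym (⟨⟩-≢ {α = x ∷ α ++ β} {y ∷ γ} (x≢y ∘ List.∷-injectiveˡ)))

-- The ideal and its truncated quotients.

Ideal-· : ∀ c {f : Series r} → Ideal f → Ideal (c · f)
Ideal-· c {f} I = resp (λ α → trans (⊛-·ˡ c 𝟙 f α) (cong (c ℤ.*_) (𝟙-⊛ f α))) (mulˡ (c · 𝟙) I)

Ideal-conjugate : ∀ {f g : Series r} α β → Ideal (f ⊖ g) →
                  Ideal (⟨ α ⟩ ⊛ f ⊛ ⟨ β ⟩ ⊖ ⟨ α ⟩ ⊛ g ⊛ ⟨ β ⟩)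
Ideal-conjugate {f = f} {g} α β I =
  resp (λ γ → trans (⊛-congˡ ⟨ β ⟩ (⊛-⊖ʳ ⟨ α ⟩ f g) γ) (⊛-⊖ˡ (⟨ α ⟩ ⊛ f) (⟨ α ⟩ ⊛ g) ⟨ β ⟩ γ))
    (mulʳ ⟨ β ⟩ (mulˡ ⟨ α ⟩ I))

biword-++ : (u w : Word r) {v t : Word r} → length u ≡ length w →
            biword (u ++ v) (w ++ t) ≡ biword u w ++ biword v t
biword-++ []      []      eq = refl
biword-++ (x ∷ u) (a ∷ w) eq = cong ((x , a) ∷_) (biword-++ u w (ℕ.suc-injective eq))

biword-factor : (p p′ : Word r) → ∀ x y a b q q′ → length p ≡ length p′ →
  ⟨ biword p p′ ⟩ ⊛ ⟨ biword (x ∷ y ∷ []) (a ∷ b ∷ []) ⟩ ⊛ ⟨ biword q q′ ⟩ ≗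
  ⟨ biword (p ++ x ∷ y ∷ q) (p′ ++ a ∷ b ∷ q′) ⟩
biword-factor p p′ x y a b q q′ eq α =
  trans (⊛-congˡ ⟨ biword q q′ ⟩ (⟨⟩-⊛ (biword p p′) ((x , a) ∷ (y , b) ∷ [])) α)
  (trans (⟨⟩-⊛ (biword p p′ ++ (x , a) ∷ (y , b) ∷ []) (biword q q′) α)
  (cong (λ β → ⟨ β ⟩ α)
    (trans (List.++-assoc (biword p p′) _ _) (sym (biword-++ p p′ eq)))))

-- Formal sums modulo the ideal and modulo the terms of length at least N.
module Truncation (r N : ℕ) where

  infix 4 _∼_
  -- For `N = suc n` this is the condition that `ClosedIdeal (f ⊖ g)` imposes at n.
  record _∼_ (f g : Series r) : Set where
    constructor modulo
    field
      difference : Series r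
      ideal      : Ideal difference
      agree      : ∀ α → length α ℕ.< N → (f ⊖ g) α ≡ difference α

  ideal⇒∼ : ∀ {f g} → Ideal (f ⊖ g) → f ∼ g
  ideal⇒∼ I = modulo _ I λ _ _ → refl

  agree⇒∼ : ∀ {f g} → (∀ α → length α ℕ.< N → f α ≡ g α) → f ∼ g
  agree⇒∼ f≡g = modulo 𝟘 zer λ α α<N → ℤ.i≡j⇒i-j≡0 (f≡g α α<N)

  ≗⇒∼ : ∀ {f g} → f ≗ g → f ∼ g
  ≗⇒∼ f≗g = agree⇒∼ (λ α _ → f≗g α)

  ∼-sym : ∀ {f g} → f ∼ g → g ∼ f
  ∼-sym {f} {g} (modulo h I eq) = modulo (⊝ h) (neg I) λ α α<N →
    trans (lemma (f α) (g α)) (cong ℤ.-_ (eq α α<N))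
    where
    lemma : ∀ a b → b ℤ.- a ≡ ℤ.- (a ℤ.- b)
    lemma = solve-∀

  ∼-trans : ∀ {f g k} → f ∼ g → g ∼ k → f ∼ k
  ∼-trans {f} {g} {k} (modulo h I eq) (modulo h′ I′ eq′) = modulo (h ⊕ h′) (add I I′) λ α α<N →
    trans (lemma (f α) (g α) (k α)) (cong₂ ℤ._+_ (eq α α<N) (eq′ α α<N))
    where
    lemma : ∀ a b c → a ℤ.- c ≡ (a ℤ.- b) ℤ.+ (b ℤ.- c)
    lemma = solve-∀

  ⊕-cong : ∀ {f f′ g g′} → f ∼ f′ → g ∼ g′ → f ⊕ g ∼ f′ ⊕ g′
  ⊕-cong {f} {f′} {g} {g′} (modulo h I eq) (modulo h′ I′ eq′) = modulo (h ⊕ h′) (add I I′) λ α α<N →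
    trans (lemma (f α) (f′ α) (g α) (g′ α)) (cong₂ ℤ._+_ (eq α α<N) (eq′ α α<N))
    where
    lemma : ∀ a a′ b b′ → (a ℤ.+ b) ℤ.- (a′ ℤ.+ b′) ≡ (a ℤ.- a′) ℤ.+ (b ℤ.- b′)
    lemma = solve-∀

  ·-cong : ∀ {c d f g} → c ≡ d → f ∼ g → c · f ∼ d · g
  ·-cong {c} {.c} {f} {g} refl (modulo h I eq) = modulo (c · h) (Ideal-· c I) λ α α<N →
    trans (lemma c (f α) (g α)) (cong (c ℤ.*_) (eq α α<N))
    where
    lemma : ∀ c a b → c ℤ.* a ℤ.- c ℤ.* b ≡ c ℤ.* (a ℤ.- b)
    lemma = solve-∀

  ⊝-cong : ∀ {f g} → f ∼ g → ⊝ f ∼ ⊝ g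
  ⊝-cong {f} {g} (modulo h I eq) = modulo (⊝ h) (neg I) λ α α<N →
    trans (lemma (f α) (g α)) (cong ℤ.-_ (eq α α<N))
    where
    lemma : ∀ a b → ℤ.- a ℤ.- ℤ.- b ≡ ℤ.- (a ℤ.- b)
    lemma = solve-∀

  truncatedModule : LeftModule ℤ.+-*-ring 0ℓ 0ℓ
  truncatedModule = record
    { Carrierᴹ = Series r
    ; _≈ᴹ_ = _∼_
    ; _+ᴹ_ = _⊕_
    ; _*ₗ_ = _·_
    ; 0ᴹ = 𝟘
    ; -ᴹ_ = ⊝_
    ; isLeftModule = record
      { isLeftSemimodule = record
        { +ᴹ-isCommutativeMonoid = record
          { isMonoid = record
            { isSemigroup = record
              { isMagma = record
                { isEquivalence = record
                  { refl = ≗⇒∼ (λ _ → refl) ; sym = ∼-sym ; trans = ∼-trans }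
                ; ∙-cong = ⊕-cong
                }
              ; assoc = λ f g h → ≗⇒∼ (λ α → ℤ.+-assoc (f α) (g α) (h α))
              }
            ; identity = (λ f → ≗⇒∼ (λ α → ℤ.+-identityˡ (f α)))
                       , (λ f → ≗⇒∼ (λ α → ℤ.+-identityʳ (f α)))
            }
          ; comm = λ f g → ≗⇒∼ (λ α → ℤ.+-comm (f α) (g α))
          }
        ; isPreleftSemimodule = record
          { *ₗ-cong = ·-cong
          ; *ₗ-zeroˡ = λ f → ≗⇒∼ (λ α → ℤ.*-zeroˡ (f α))
          ; *ₗ-distribʳ = λ f c d → ≗⇒∼ (λ α → ℤ.*-distribʳ-+ (f α) c d)
          ; *ₗ-identityˡ = λ f → ≗⇒∼ (λ α → ℤ.*-identityˡ (f α))
          ; *ₗ-assoc = λ c d f → ≗⇒∼ (λ α → ℤ.*-assoc c d (f α))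
          ; *ₗ-zeroʳ = λ c → ≗⇒∼ (λ α → ℤ.*-zeroʳ c)
          ; *ₗ-distribˡ = λ c f g → ≗⇒∼ (λ α → ℤ.*-distribˡ-+ c (f α) (g α))
          }
        }
      ; -ᴹ‿cong = ⊝-cong
      ; -ᴹ‿inverse = (λ f → ≗⇒∼ (λ α → ℤ.+-inverseˡ (f α)))
                   , (λ f → ≗⇒∼ (λ α → ℤ.+-inverseʳ (f α)))
      }
    }

  open LeftModule truncatedModule using (≈ᴹ-refl)
  open Alternation truncatedModule r
  open MacMahon truncatedModule r

  φ : Word r → Word r → Series r
  φ u w = ⟨ biword u w ⟩

  φ-rightQuantum : RightQuantum φ
  φ-rightQuantum = record { rel₁ = rel₁ ; rel₂ = rel₂ }
    where
    rel₁ : ∀ p p′ x y a q q′ → length p ≡ length p′ →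
           φ (p ++ x ∷ y ∷ q) (p′ ++ a ∷ a ∷ q′) ∼ φ (p ++ y ∷ x ∷ q) (p′ ++ a ∷ a ∷ q′)
    rel₁ p p′ x y a q q′ eq with x Fin.≟ y
    -- The generators require distinct top letters; for equal ones both sides coincide.
    ... | yes refl = ≈ᴹ-refl
    ... | no  x≢y  = ideal⇒∼ (resp
      (λ α → cong₂ ℤ._-_ (biword-factor p p′ x y a a q q′ eq α) (biword-factor p p′ y x a a q q′ eq α))
      (Ideal-conjugate (biword p p′) (biword q q′) (gen (R1 x≢y a))))
    rel₂ : ∀ p p′ x y a b q q′ → length p ≡ length p′ →
           φ (p ++ x ∷ y ∷ q) (p′ ++ a ∷ b ∷ q′) ⊕ φ (p ++ x ∷ y ∷ q) (p′ ++ b ∷ a ∷ q′) ∼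
           φ (p ++ y ∷ x ∷ q) (p′ ++ a ∷ b ∷ q′) ⊕ φ (p ++ y ∷ x ∷ q) (p′ ++ b ∷ a ∷ q′)
    rel₂ p p′ x y a b q q′ eq with x Fin.≟ y
    ... | yes refl = ≈ᴹ-refl
    ... | no  x≢y  = ideal⇒∼ (resp
      {f = ⟨ biword p p′ ⟩ ⊛ pair x y ⊛ ⟨ biword q q′ ⟩ ⊖ ⟨ biword p p′ ⟩ ⊛ pair y x ⊛ ⟨ biword q q′ ⟩}
      (λ α → cong₂ ℤ._-_ (factor x y α) (factor y x α))
      (Ideal-conjugate {f = pair x y} {pair y x} (biword p p′) (biword q q′)
        (resp (λ α → lemma (e x y a b α) (e y x a b α) (e y x b a α) (e x y b a α)) (gen (R2 x≢y a b)))))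
      where
      e : (x y a b : Fin r) → Series r
      e x y a b = ⟨ biword (x ∷ y ∷ []) (a ∷ b ∷ []) ⟩
      pair : Fin r → Fin r → Series r
      pair x y = e x y a b ⊕ e x y b a
      lemma : ∀ s t u v → s ℤ.- (t ℤ.+ u ℤ.- v) ≡ s ℤ.+ v ℤ.- (t ℤ.+ u)
      lemma = solve-∀
      factor : ∀ x y → ⟨ biword p p′ ⟩ ⊛ pair x y ⊛ ⟨ biword q q′ ⟩ ≗
               φ (p ++ x ∷ y ∷ q) (p′ ++ a ∷ b ∷ q′) ⊕ φ (p ++ x ∷ y ∷ q) (p′ ++ b ∷ a ∷ q′)
      factor x y α = trans (⊛-congˡ ⟨ biword q q′ ⟩ (⊛-⊕ʳ ⟨ biword p p′ ⟩ (e x y a b) (e x y b a)) α)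
        (trans (⊛-⊕ˡ (⟨ biword p p′ ⟩ ⊛ e x y a b) (⟨ biword p p′ ⟩ ⊛ e x y b a)
                      ⟨ biword q q′ ⟩ α)
        (cong₂ ℤ._+_ (biword-factor p p′ x y a b q q′ eq α) (biword-factor p p′ x y b a q q′ eq α)))

  φ-zero : ∀ u w → N ℕ.≤ length u → N ℕ.≤ length w → φ u w ∼ 𝟘
  φ-zero u w N≤u N≤w = agree⇒∼ λ α α<N → ⟨⟩-≢ {α = biword u w} {α} λ { refl → ℕ.<⇒≱ α<N
    (subst (N ℕ.≤_) (sym (List.length-zipWith _,_ u w)) (ℕ.⊓-glb N≤u N≤w)) }

  -- The homogeneous part of Bos of degree n.
  bosTerms : ℕ → Series r
  bosTerms n = ∑ (words (allFin r) n) λ w → φ (rearrange w) w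

  bosTerms-zero : ∀ n α → n ≢ length α → bosTerms n α ≡ 0ℤ
  bosTerms-zero n α n≢α = trans (∑-apply (words (allFin r) n) (λ w → φ (rearrange w) w) α)
    (ΣZ.sum-zero (All.map (λ {w} → vanish w) (words-length (allFin r) n)))
    where
    vanish : ∀ w → length w ≡ n → φ (rearrange w) w α ≡ 0ℤ
    vanish w w≡n = ⟨⟩-≢ {α = biword (rearrange w) w} {α} λ { refl → n≢α (sym (trans (List.length-zipWith _,_ (rearrange w) w)
      (trans (cong (ℕ._⊓ length w) (rearrange-length w)) (trans (ℕ.⊓-idem (length w)) w≡n)))) }

  -- `Bos` selects its words by the length of the biword at which it is evaluated. Below length N
  -- this matches the sum of the homogeneous parts, of which only that of degree `length α`
  -- contributes.
  Bos-agree : ∀ α → length α ℕ.< N → Bos r α ≡ ∑ (downFrom N) bosTerms α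
  Bos-agree α α<N = sym (trans (∑-apply (downFrom N) bosTerms α) (single N α<N))
    where
    rest : ∀ n → n ℕ.≤ length α → ΣZ.sum (downFrom n) (λ n → bosTerms n α) ≡ 0ℤ
    rest zero    _   = refl
    rest (suc n) n<α = cong₂ ℤ._+_ (bosTerms-zero n α (ℕ.<⇒≢ n<α)) (rest n (ℕ.<⇒≤ n<α))
    single : ∀ n → length α ℕ.< n → ΣZ.sum (downFrom n) (λ n → bosTerms n α) ≡ Bos r α
    single (suc n) α<1+n = by-cases (length α ℕ.≟ n)
      where
      by-cases : Dec (length α ≡ n) → ΣZ.sum (downFrom (suc n)) (λ n → bosTerms n α) ≡ Bos r α
      by-cases (yes refl) =
        trans (cong (λ c → bosTerms n α ℤ.+ c) (rest n ℕ.≤-refl)) (ℤ.+-identityʳ (bosTerms n α))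
      by-cases (no  α≢n)  = trans (cong₂ ℤ._+_ (bosTerms-zero n α (α≢n ∘ sym))
        (single n (ℕ.≤∧≢⇒< (ℕ.≤-pred α<1+n) α≢n))) (ℤ.+-identityˡ (Bos r α))

  φ-⊛-bosTerms : ∀ σ J n → length σ ≡ length J →
    φ σ J ⊛ bosTerms n ≗ ∑ (words (allFin r) n) λ w → φ (σ ++ rearrange w) (J ++ w)
  φ-⊛-bosTerms σ J n eq α = trans (⊛-∑ʳ (φ σ J) (words (allFin r) n) (λ w → φ (rearrange w) w) α)
    (∑-cong (words (allFin r) n) (λ w α → trans (⟨⟩-⊛ (biword σ J) (biword (rearrange w) w) α)
      (cong (λ β → ⟨ β ⟩ α) (sym (biword-++ σ J eq)))) α)

  φ-⊛-Bos : ∀ σ J → length σ ≡ length J → φ σ J ⊛ Bos r ∼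
    ∑ (downFrom N) λ n → ∑ (words (allFin r) n) λ w → φ (σ ++ rearrange w) (J ++ w)
  φ-⊛-Bos σ J eq = agree⇒∼ λ α α<N →
    trans (⊛-congʳ-≤ (φ σ J) α (λ γ γ≤α → Bos-agree γ (ℕ.≤-<-trans γ≤α α<N)))
    (trans (⊛-∑ʳ (φ σ J) (downFrom N) bosTerms α)
    (∑-cong (downFrom N) (λ n → φ-⊛-bosTerms σ J n eq) α))

-- Conclusion for the formal sums Ferm and Bos.

Ferm-⊛ : ∀ (g : Series r) → Ferm r ⊛ g ≗ ∑ (subsets r) λ J →
  (-1ℤ ℤ.^ length J) · ∑ (permutations J) λ σ → (-1ℤ ℤ.^ inv σ) · (⟨ biword σ J ⟩ ⊛ g)
Ferm-⊛ {r} g α = trans (⊛-∑ˡ (subsets r) (λ J → (-1ℤ ℤ.^ length J) · inner J) g α)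
  (∑-cong (subsets r) (λ J α → trans (⊛-·ˡ (-1ℤ ℤ.^ length J) (inner J) g α)
    (cong (λ c → (-1ℤ ℤ.^ length J) ℤ.* c)
      (trans (⊛-∑ˡ (permutations J) (λ σ → (-1ℤ ℤ.^ inv σ) · ⟨ biword σ J ⟩) g α)
        (∑-cong (permutations J) (λ σ → ⊛-·ˡ (-1ℤ ℤ.^ inv σ) ⟨ biword σ J ⟩ g) α)))) α)
  where
  inner : Word r → Series r
  inner J = ∑ (permutations J) λ σ → (-1ℤ ℤ.^ inv σ) · ⟨ biword σ J ⟩

theorem1 : (r : ℕ) → r ≥ 1 → Ferm r ⊛ Bos r ≈ 𝟙
theorem1 r _ n = difference , ideal , λ α α≤n → agree α (s≤s α≤n)
  where
  -- The closed ideal asks for agreement up to length n inclusive, the truncated equality for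
  -- agreement strictly below its bound.
  open Truncation r (suc n)
  open MacMahon truncatedModule r
  Ferm⊛Bos∼𝟙 : Ferm r ⊛ Bos r ∼ 𝟙
  Ferm⊛Bos∼𝟙 = ∼-trans (≗⇒∼ (Ferm-⊛ (Bos r)))
    (macMahon φ-rightQuantum φ-zero (AllPairs.tabulate⁺-< (λ i<j → i<j)) (λ σ J → φ σ J ⊛ Bos r) φ-⊛-Bos)
  open _∼_ Ferm⊛Bos∼𝟙
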